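{- Let $\mathcal A$ be a well-structured abstract domain with abstraction and concretisation functions $\alpha:\mathcal Q\to\mathcal A$ and $\gamma:\mathcal A\to\mathcal Q$. Then there exist monotone maps $\alpha':\mathcal S(\mathcal H_V)\to\mathcal A$ and $\gamma':\mathcal A\to\mathcal S(\mathcal H_V)$ forming a Galois embedding (with $\mathcal S(\mathcal H_V)$ ordered by inclusion) such that $\alpha=\alpha'\circ\alpha_s$ and $\gamma=\gamma_s\circ\gamma'$.
   Context: Fix a finite set $V$ of quantum variables, each a qubit with state space $\mathcal H_q\cong\mathbb C^2$; $\mathcal H_V=\bigotimes_{q\in V}\mathcal H_q$. $\mathcal D(\mathcal H_V)$ is the set of partial density operators on $\mathcal H_V$ (positive operators of trace at most $1$); $\lceil\rho\rceil$ denotes the support of $\rho$. The concrete domain is $\mathcal Q=2^{\mathcal D(\mathcal H_V)}$ ordered by inclusion. A pair of monotone maps $(\alpha,\gamma)$ between posets is a Galois connection if $c\le\gamma(a)\iff\alpha(c)\le a$, and a Galois embedding if moreover $\alpha\circ\gamma=\mathrm{id}$. A complete lattice $(\mathcal A,\le_{\mathcal A},\vee,\wedge,\bot,\top)$ with monotone $\alpha:\mathcal Q\to\mathcal A$, $\gamma:\mathcal A\to\mathcal Q$ is a well-structured abstract domain if (a) $(\alpha,\gamma)$ is a Galois embedding, and (b) for any family $\rho_i\in\mathcal D(\mathcal H_V)$ and reals $x_i>0$ with $\sum_i x_i\rho_i\in\mathcal D(\mathcal H_V)$, $\alpha(\sum_i x_i\rho_i)=\bigvee_i\alpha(\rho_i)$,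 where $\alpha(\rho)=\alpha(\{\rho\})$. The subspace domain $\mathcal S(\mathcal H_V)$ is the set of all subspaces of $\mathcal H_V$ ordered by inclusion, with join $P\vee Q=\mathrm{span}(P\cup Q)$ and meet $\cap$; its functions are $\gamma_s(P)=\{\rho\in\mathcal D(\mathcal H_V):\lceil\rho\rceil\subseteq P\}$ and $\alpha_s(R)=\bigvee\{\lceil\rho\rceil:\rho\in R\}$. -}

module Defs where

open import Algebra.Bundles using (AbelianGroup; CommutativeRing)
import Algebra.Construct.DirectProduct as DirectProduct
import Algebra.Properties.Ring as RingProperties
import Algebra.Properties.Semiring.Sum as SemiringSum
import Algebra.Solver.Ring.NaturalCoefficients.Default as SemiringSolver
open import Data.Fin.Base using (Fin)
open import Data.List.Base using (List; foldr)
open import Data.List.Relation.Binary.Subset.Propositional using () renaming (_⊆_ to _⊆ᴸ_)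
open import Data.List.Relation.Unary.Unique.Propositional using (Unique)
open import Data.Nat.Base using (ℕ) renaming (_^_ to _^ℕ_)
open import Data.Product.Base using (Σ; ∃; ∃-syntax; _×_; _,_; proj₁; proj₂)
open import Function.Base using (_∘_)
open import Function.Bundles using (_⇔_)
open import Level using (Level; 0ℓ; suc; _⊔_)
open import Relation.Binary.Bundles using (Poset)
open import Relation.Binary.Core using (Rel)
open import Relation.Binary.Definitions using (_Respects_)
import Relation.Binary.Construct.On as On
open import Relation.Binary.Morphism.Bundles using (PosetHomomorphism)
import Relation.Binary.Reasoning.Setoid as SetoidReasoning
open import Relation.Binary.Structures using (IsDecTotalOrder)
open import Relation.Nullary.Negation using (¬_)
open import Relation.Unary using (Pred; Satisfiable; _∈_; _⊆_; ⋃)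
open import Relation.Unary.Relation.Binary.Subset using (⊆-poset)

private
  variable
    c ℓ₁ ℓ₂ c′ ℓ₁′ ℓ₂′ : Level

-- The library has no real numbers, so they enter axiomatically: classically
-- every structure of this kind is isomorphic to ℝ.  The order is required to
-- be decidable, as it is for the reals of classical mathematics.
record CompleteOrderedField : Set₁ where
  field
    commutativeRing : CommutativeRing 0ℓ 0ℓ

  open CommutativeRing commutativeRing public

  infix 4 _≤_

  field
    _≤_             : Rel Carrier 0ℓ
    isDecTotalOrder : IsDecTotalOrder _≈_ _≤_
    +-monoˡ-≤       : ∀ z {x y} → x ≤ y → x + z ≤ y + z
    *-nonneg        : ∀ {x y} → 0# ≤ x → 0# ≤ y → 0# ≤ x * y
    1≉0             : ¬ (1# ≈ 0#)
    inverse         : ∀ {x} → ¬ (x ≈ 0#) → ∃[ y ] x * y ≈ 1#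

  IsUpperBound : Pred Carrier 0ℓ → Pred Carrier 0ℓ
  IsUpperBound S b = ∀ x → x ∈ S → x ≤ b

  field
    supremum : ∀ S → Satisfiable S → Satisfiable (IsUpperBound S) →
               ∃[ s ] IsUpperBound S s × (∀ b → IsUpperBound S b → s ≤ b)

  infix 4 _<_

  _<_ : Rel Carrier 0ℓ
  x < y = x ≤ y × ¬ (x ≈ y)

-- Joins and meets are required for families indexed by types in Set only.  A
-- lattice such as 𝒮 below has its carrier in Set₁ but, predicatively, no joins of
-- families indexed by Set₁.
record CompleteLattice (c ℓ₁ ℓ₂ : Level) : Set (suc (0ℓ ⊔ c ⊔ ℓ₁ ⊔ ℓ₂)) where
  field
    poset : Poset c ℓ₁ ℓ₂

  open Poset poset public

  field
    ⋁          : {I : Set} → (I → Carrier) → Carrier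
    ⋁-upper    : ∀ {I : Set} (f : I → Carrier) i → f i ≤ ⋁ f
    ⋁-least    : ∀ {I : Set} (f : I → Carrier) b → (∀ i → f i ≤ b) → ⋁ f ≤ b
    ⋀          : {I : Set} → (I → Carrier) → Carrier
    ⋀-lower    : ∀ {I : Set} (f : I → Carrier) i → ⋀ f ≤ f i
    ⋀-greatest : ∀ {I : Set} (f : I → Carrier) b → (∀ i → b ≤ f i) → b ≤ ⋀ f

module _ (C : Poset c ℓ₁ ℓ₂) (A : Poset c′ ℓ₁′ ℓ₂′) where

  private
    module C = Poset C
    module A = Poset A

  IsGaloisConnection : PosetHomomorphism C A → PosetHomomorphism A C → Set _
  IsGaloisConnection α γ = ∀ c a → (c C.≤ γ.⟦ a ⟧) ⇔ (α.⟦ c ⟧ A.≤ a)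
    where
    module α = PosetHomomorphism α
    module γ = PosetHomomorphism γ

  IsGaloisEmbedding : PosetHomomorphism C A → PosetHomomorphism A C → Set _
  IsGaloisEmbedding α γ = IsGaloisConnection α γ × (∀ a → α.⟦ γ.⟦ a ⟧ ⟧ A.≈ a)
    where
    module α = PosetHomomorphism α
    module γ = PosetHomomorphism γ

module Complex (R : CompleteOrderedField) where

  private
    module R = CompleteOrderedField R
    module Poly = SemiringSolver R.commutativeSemiring

  ℂ : Set
  ℂ = R.Carrier × R.Carrier

  re im : ℂ → R.Carrier
  re = proj₁
  im = proj₂

  private
    _·_ : ℂ → ℂ → ℂ
    (a , b) · (c , d) = a R.* c R.- b R.* d , a R.* d R.+ b R.* c

    _≈ᶜ_ : Rel ℂ 0ℓ
    (a , b) ≈ᶜ (c , d) = (a R.≈ c) × (b R.≈ d)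

    1ᶜ : ℂ
    1ᶜ = R.1# , R.0#

    _+ᶜ_ : ℂ → ℂ → ℂ
    (a , b) +ᶜ (c , d) = a R.+ c , b R.+ d

    module additive =
      AbelianGroup (DirectProduct.abelianGroup R.+-abelianGroup R.+-abelianGroup)

    open Poly using (con; _:+_; _:*_; _:=_)
    open SetoidReasoning additive.setoid

    -- The same product with i² = m for m = -1: its laws are semiring identities.
    m : R.Carrier
    m = R.- R.1#

    _∗_ : ℂ → ℂ → ℂ
    (a , b) ∗ (c , d) = a R.* c R.+ m R.* (b R.* d) , a R.* d R.+ b R.* c

    ·≈∗ : ∀ x y → (x · y) ≈ᶜ (x ∗ y)
    ·≈∗ (a , b) (c , d) = R.+-congˡ (R.sym (RingProperties.-1*x≈-x R.ring _)) , R.refl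

    ∗-cong : ∀ {w x y z} → w ≈ᶜ x → y ≈ᶜ z → (w ∗ y) ≈ᶜ (x ∗ z)
    ∗-cong (p , q) (r , s) =
      R.+-cong (R.*-cong p r) (R.*-congˡ (R.*-cong q s)) ,
      R.+-cong (R.*-cong p s) (R.*-cong q r)

    ∗-assoc : ∀ x y z → ((x ∗ y) ∗ z) ≈ᶜ (x ∗ (y ∗ z))
    ∗-assoc (a , b) (c , d) (e , f) =
      Poly.solve 7 (λ m a b c d e f →
        (a :* c :+ m :* (b :* d)) :* e :+ m :* ((a :* d :+ b :* c) :* f) :=
        a :* (c :* e :+ m :* (d :* f)) :+ m :* (b :* (c :* f :+ d :* e)))
        R.refl m a b c d e f ,
      Poly.solve 7 (λ m a b c d e f →
        (a :* c :+ m :* (b :* d)) :* f :+ (a :* d :+ b :* c) :* e :=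
        a :* (c :* f :+ d :* e) :+ b :* (c :* e :+ m :* (d :* f)))
        R.refl m a b c d e f

    ∗-comm : ∀ x y → (x ∗ y) ≈ᶜ (y ∗ x)
    ∗-comm (a , b) (c , d) =
      Poly.solve 5 (λ m a b c d → a :* c :+ m :* (b :* d) := c :* a :+ m :* (d :* b))
        R.refl m a b c d ,
      Poly.solve 4 (λ a b c d → a :* d :+ b :* c := c :* b :+ d :* a) R.refl a b c d

    ∗-identityˡ : ∀ x → (1ᶜ ∗ x) ≈ᶜ x
    ∗-identityˡ (a , b) =
      Poly.solve 3 (λ m a b → con 1 :* a :+ m :* (con 0 :* b) := a) R.refl m a b ,
      Poly.solve 2 (λ a b → con 1 :* b :+ con 0 :* a := b) R.refl a b

    ∗-distribˡ : ∀ x y z → (x ∗ (y +ᶜ z)) ≈ᶜ ((x ∗ y) +ᶜ (x ∗ z))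
    ∗-distribˡ (a , b) (c , d) (e , f) =
      Poly.solve 7 (λ m a b c d e f →
        a :* (c :+ e) :+ m :* (b :* (d :+ f)) :=
        (a :* c :+ m :* (b :* d)) :+ (a :* e :+ m :* (b :* f)))
        R.refl m a b c d e f ,
      Poly.solve 6 (λ a b c d e f →
        a :* (d :+ f) :+ b :* (c :+ e) :=
        (a :* d :+ b :* c) :+ (a :* f :+ b :* e))
        R.refl a b c d e f

    ·-cong : ∀ {w x y z} → w ≈ᶜ x → y ≈ᶜ z → (w · y) ≈ᶜ (x · z)
    ·-cong (p , q) (r , s) =
      R.+-cong (R.*-cong p r) (R.-‿cong (R.*-cong q s)) ,
      R.+-cong (R.*-cong p s) (R.*-cong q r)

    ·-assoc : ∀ x y z → ((x · y) · z) ≈ᶜ (x · (y · z))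
    ·-assoc x y z = begin
      (x · y) · z  ≈⟨ ·≈∗ (x · y) z ⟩
      (x · y) ∗ z  ≈⟨ ∗-cong (·≈∗ x y) additive.refl ⟩
      (x ∗ y) ∗ z  ≈⟨ ∗-assoc x y z ⟩
      x ∗ (y ∗ z)  ≈⟨ ∗-cong {x} additive.refl (·≈∗ y z) ⟨
      x ∗ (y · z)  ≈⟨ ·≈∗ x (y · z) ⟨
      x · (y · z)  ∎

    ·-comm : ∀ x y → (x · y) ≈ᶜ (y · x)
    ·-comm x y = begin
      x · y  ≈⟨ ·≈∗ x y ⟩
      x ∗ y  ≈⟨ ∗-comm x y ⟩
      y ∗ x  ≈⟨ ·≈∗ y x ⟨
      y · x  ∎

    ·-identityˡ : ∀ x → (1ᶜ · x) ≈ᶜ x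
    ·-identityˡ x = additive.trans (·≈∗ 1ᶜ x) (∗-identityˡ x)

    ·-distribˡ : ∀ x y z → (x · (y +ᶜ z)) ≈ᶜ ((x · y) +ᶜ (x · z))
    ·-distribˡ x y z = begin
      x · (y +ᶜ z)        ≈⟨ ·≈∗ x (y +ᶜ z) ⟩
      x ∗ (y +ᶜ z)        ≈⟨ ∗-distribˡ x y z ⟩
      (x ∗ y) +ᶜ (x ∗ z)  ≈⟨ additive.∙-cong (·≈∗ x y) (·≈∗ x z) ⟨
      (x · y) +ᶜ (x · z)  ∎

    ·-distribʳ : ∀ x y z → ((y +ᶜ z) · x) ≈ᶜ ((y · x) +ᶜ (z · x))
    ·-distribʳ x y z = begin
      (y +ᶜ z) · x        ≈⟨ ·-comm (y +ᶜ z) x ⟩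
      x · (y +ᶜ z)        ≈⟨ ·-distribˡ x y z ⟩
      (x · y) +ᶜ (x · z)  ≈⟨ additive.∙-cong (·-comm x y) (·-comm x z) ⟩
      (y · x) +ᶜ (z · x)  ∎

  ℂ-commutativeRing : CommutativeRing 0ℓ 0ℓ
  ℂ-commutativeRing = record
    { Carrier = ℂ
    ; _≈_ = _≈ᶜ_
    ; _+_ = _+ᶜ_
    ; _*_ = _·_
    ; -_  = λ (a , b) → R.- a , R.- b
    ; 0#  = R.0# , R.0#
    ; 1#  = 1ᶜ
    ; isCommutativeRing = record
      { isRing = record
        { +-isAbelianGroup = additive.isAbelianGroup
        ; *-cong = ·-cong
        ; *-assoc = ·-assoc
        ; *-identity = ·-identityˡ ,
            λ x → additive.trans (·-comm x 1ᶜ) (·-identityˡ x)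
        ; distrib = ·-distribˡ , ·-distribʳ
        }
      ; *-comm = ·-comm
      }
    }

  conj : ℂ → ℂ
  conj (a , b) = a , R.- b

  fromReal : R.Carrier → ℂ
  fromReal a = a , R.0#

-- V is the set Fin n of qubits.
module Quantum (R : CompleteOrderedField) (n : ℕ) where

  private
    module R = CompleteOrderedField R

  open Complex R public

  private
    module ℂ = CommutativeRing ℂ-commutativeRing
    module Sum = SemiringSum ℂ.semiring

  -- k : Fin (2 ^ n) stands for the element |b₁⟩ ⊗ ⋯ ⊗ |bₙ⟩ of the computational
  -- basis of (ℂ²)^⊗ⁿ, where b = Data.Fin.Base.finToFun k : Fin n → Fin 2.
  Basis : Set
  Basis = Fin (2 ^ℕ n)

  ℋ : Set
  ℋ = Basis → ℂ

  infix 4 _≈ᵥ_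
  infixl 6 _+ᵥ_
  infixr 7 _·ᵥ_ _⟨$⟩_

  _≈ᵥ_ : Rel ℋ 0ℓ
  u ≈ᵥ v = ∀ i → u i ℂ.≈ v i

  0ᵥ : ℋ
  0ᵥ _ = ℂ.0#

  _+ᵥ_ : ℋ → ℋ → ℋ
  (u +ᵥ v) i = u i ℂ.+ v i

  _·ᵥ_ : ℂ → ℋ → ℋ
  (z ·ᵥ v) i = z ℂ.* v i

  ⟨_∣_⟩ : ℋ → ℋ → ℂ
  ⟨ u ∣ v ⟩ = Sum.sum (λ i → conj (u i) ℂ.* v i)

  -- M i j = ⟨i|M|j⟩.
  Operator : Set
  Operator = Basis → Basis → ℂ

  _⟨$⟩_ : Operator → ℋ → ℋ
  (M ⟨$⟩ v) i = Sum.sum (λ j → M i j ℂ.* v j)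

  trace : Operator → ℂ
  trace M = Sum.sum (λ i → M i i)

  IsSelfAdjoint : Pred Operator 0ℓ
  IsSelfAdjoint M = ∀ i j → M i j ℂ.≈ conj (M j i)

  -- ⟨v|M|v⟩ is real when M is self-adjoint.
  IsPositive : Pred Operator 0ℓ
  IsPositive M = IsSelfAdjoint M × (∀ v → R.0# R.≤ re ⟨ v ∣ M ⟨$⟩ v ⟩)

  record 𝒟 : Set where
    field
      operator : Operator
      positive : IsPositive operator
      trace≤1  : re (trace operator) R.≤ R.1#

  open 𝒟 public

  infix 4 _≈ᴰ_

  _≈ᴰ_ : Rel 𝒟 0ℓ
  ρ ≈ᴰ σ = ∀ i j → operator ρ i j ℂ.≈ operator σ i j

  -- The subsets of 𝒟, i.e. the predicates compatible with equality of operators.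
  record 𝒬 : Set₁ where
    field
      member   : Pred 𝒟 0ℓ
      respects : member Respects _≈ᴰ_

  open 𝒬 public

  𝒬-poset : Poset _ _ _
  𝒬-poset = On.poset (⊆-poset 𝒟 0ℓ) member

  ｛_｝ : 𝒟 → 𝒬
  ｛ ρ ｝ = record
    { member   = ρ ≈ᴰ_
    ; respects = λ σ≈τ ρ≈σ i j → ℂ.trans (ρ≈σ i j) (σ≈τ i j)
    }

  record 𝒮 : Set₁ where
    field
      carrier    : Pred ℋ 0ℓ
      ≈-closed   : carrier Respects _≈ᵥ_
      0-closed   : 0ᵥ ∈ carrier
      +-closed   : ∀ {u v} → u ∈ carrier → v ∈ carrier → u +ᵥ v ∈ carrier
      ·-closed   : ∀ z {v} → v ∈ carrier → z ·ᵥ v ∈ carrier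

  open 𝒮 public

  𝒮-poset : Poset _ _ _
  𝒮-poset = On.poset (⊆-poset ℋ 0ℓ) carrier

  data Span (S : Pred ℋ 0ℓ) : Pred ℋ 0ℓ where
    generator : ∀ {v} → v ∈ S → v ∈ Span S
    resp      : (Span S) Respects _≈ᵥ_
    zero      : 0ᵥ ∈ Span S
    plus      : ∀ {u v} → u ∈ Span S → v ∈ Span S → u +ᵥ v ∈ Span S
    scale     : ∀ z {v} → v ∈ Span S → z ·ᵥ v ∈ Span S

  span : Pred ℋ 0ℓ → 𝒮
  span S = record
    { carrier  = Span S
    ; ≈-closed = resp
    ; 0-closed = zero
    ; +-closed = plus
    ; ·-closed = scale
    }

  ⋁ₛ : {I : Set} → (I → 𝒮) → 𝒮
  ⋁ₛ {I} P = span (⋃ I (carrier ∘ P))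

  private
    ⟨∣⟩-congʳ : ∀ u {v w} → v ≈ᵥ w → ⟨ u ∣ v ⟩ ℂ.≈ ⟨ u ∣ w ⟩
    ⟨∣⟩-congʳ u v≈w = Sum.sum-cong-≋ (λ i → ℂ.*-congˡ (v≈w i))

    ⟨∣⟩-0ʳ : ∀ u → ⟨ u ∣ 0ᵥ ⟩ ℂ.≈ ℂ.0#
    ⟨∣⟩-0ʳ u = ℂ.trans (ℂ.sym (Sum.*-distribʳ-sum ℂ.0# (conj ∘ u))) (ℂ.zeroʳ _)

    ⟨∣⟩-+ʳ : ∀ u v w → ⟨ u ∣ v +ᵥ w ⟩ ℂ.≈ ⟨ u ∣ v ⟩ ℂ.+ ⟨ u ∣ w ⟩
    ⟨∣⟩-+ʳ u v w = ℂ.trans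
      (Sum.sum-cong-≋ (λ i → ℂ.distribˡ (conj (u i)) (v i) (w i)))
      (Sum.∑-distrib-+ (λ i → conj (u i) ℂ.* v i) (λ i → conj (u i) ℂ.* w i))

    ⟨∣⟩-·ʳ : ∀ u z v → ⟨ u ∣ z ·ᵥ v ⟩ ℂ.≈ z ℂ.* ⟨ u ∣ v ⟩
    ⟨∣⟩-·ʳ u z v = ℂ.trans
      (Sum.sum-cong-≋ λ i → ℂ.trans (ℂ.sym (ℂ.*-assoc (conj (u i)) z (v i)))
        (ℂ.trans (ℂ.*-congʳ (ℂ.*-comm (conj (u i)) z)) (ℂ.*-assoc z (conj (u i)) (v i))))
      (ℂ.sym (Sum.*-distribˡ-sum z (λ i → conj (u i) ℂ.* v i)))

  _⊥ : Pred ℋ 0ℓ → 𝒮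
  S ⊥ = record
    { carrier  = λ v → ∀ u → u ∈ S → ⟨ u ∣ v ⟩ ℂ.≈ ℂ.0#
    ; ≈-closed = λ {v} {w} v≈w v⊥ u u∈S →
        ℂ.trans (ℂ.sym (⟨∣⟩-congʳ u {v} {w} v≈w)) (v⊥ u u∈S)
    ; 0-closed = λ u _ → ⟨∣⟩-0ʳ u
    ; +-closed = λ {v} {w} v⊥ w⊥ u u∈S → ℂ.trans (⟨∣⟩-+ʳ u v w)
        (ℂ.trans (ℂ.+-cong (v⊥ u u∈S) (w⊥ u u∈S)) (ℂ.+-identityʳ _))
    ; ·-closed = λ z {v} v⊥ u u∈S → ℂ.trans (⟨∣⟩-·ʳ u z v)
        (ℂ.trans (ℂ.*-congˡ (v⊥ u u∈S)) (ℂ.zeroʳ z))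
    }

  kernel : Operator → Pred ℋ 0ℓ
  kernel M v = M ⟨$⟩ v ≈ᵥ 0ᵥ

  -- In finite dimension this is the range of ρ, and the span of its eigenvectors
  -- with non-zero eigenvalue.
  ⌈_⌉ : 𝒟 → 𝒮
  ⌈ ρ ⌉ = kernel (operator ρ) ⊥

  private
    ⌈⌉-cong : ∀ {ρ σ} → ρ ≈ᴰ σ → carrier ⌈ σ ⌉ ⊆ carrier ⌈ ρ ⌉
    ⌈⌉-cong ρ≈σ v∈ u ρu≈0 = v∈ u λ i →
      ℂ.trans (Sum.sum-cong-≋ (λ j → ℂ.*-congʳ (ℂ.sym (ρ≈σ i j)))) (ρu≈0 i)

  γₛ : 𝒮 → 𝒬
  γₛ P = record
    { member   = λ ρ → carrier ⌈ ρ ⌉ ⊆ carrier P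
    ; respects = λ {ρ} {σ} ρ≈σ ⌈ρ⌉⊆P v∈ → ⌈ρ⌉⊆P (⌈⌉-cong {ρ} {σ} ρ≈σ v∈)
    }

  αₛ : 𝒬 → 𝒮
  αₛ Q = ⋁ₛ {I = ∃ (member Q)} (λ (ρ , _) → ⌈ ρ ⌉)

  _≈[_]_ : R.Carrier → R.Carrier → R.Carrier → Set
  x ≈[ ε ] y = (x R.≤ y R.+ ε) × (y R.≤ x R.+ ε)

  finiteSum : {I : Set} → (I → R.Carrier) → (I → 𝒟) → List I → Operator
  finiteSum x ρ F j k =
    foldr (λ i s → fromReal (x i) ℂ.* operator (ρ i) j k ℂ.+ s) ℂ.0# F

  -- Σᵢ xᵢρᵢ = σ for an arbitrary, possibly empty, family: convergence of the net of sums over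
  -- finite subsets of I.  ℋ is finite dimensional, so that entrywise convergence
  -- is convergence in norm.  For finite I this is the ordinary sum, and for
  -- I = ℕ, the terms being positive, the sum of the series.
  HasSum : {I : Set} → (I → R.Carrier) → (I → 𝒟) → 𝒟 → Set
  HasSum {I} x ρ σ = ∀ ε → R.0# R.< ε →
    Σ (List I) λ F₀ → ∀ F → Unique F → F₀ ⊆ᴸ F → ∀ j k →
      (re (finiteSum x ρ F j k) ≈[ ε ] re (operator σ j k)) ×
      (im (finiteSum x ρ F j k) ≈[ ε ] im (operator σ j k))

  record IsWellStructured (A : CompleteLattice c ℓ₁ ℓ₂)
    (α : PosetHomomorphism 𝒬-poset (CompleteLattice.poset A))
    (γ : PosetHomomorphism (CompleteLattice.poset A) 𝒬-poset)
    : Set (suc 0ℓ ⊔ c ⊔ ℓ₁ ⊔ ℓ₂) where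

    private
      module A = CompleteLattice A
      module α = PosetHomomorphism α

    field
      isGaloisEmbedding : IsGaloisEmbedding 𝒬-poset A.poset α γ
      α-sum : ∀ {I : Set} (x : I → R.Carrier) (ρ : I → 𝒟) (σ : 𝒟) →
              (∀ i → R.0# R.< x i) → HasSum x ρ σ →
              α.⟦ ｛ σ ｝ ⟧ A.≈ A.⋁ (λ i → α.⟦ ｛ ρ i ｝ ⟧)

{-# OPTIONS --safe #-}

-- The maps are α′ = α ∘ γₛ and γ′ = αₛ ∘ γ.  Every vector of a subspace P lies
-- in the support of a state supported in P, namely of the projector onto its
-- line, so that αₛ ∘ γₛ is the identity.  Everything else reduces to
-- γₛ (αₛ (γ a)) ⊆ γ a.  By property (b) of α, γ a contains a positive
-- combination of two states if and only if it contains both of them.  The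
-- support of ρ is generated by finitely many vectors, so if it is contained in
-- the span of the supports of the states in γ a, then it is contained in the
-- support of a single τ ∈ γ a, a mixture of finitely many states of γ a.  Hence
-- ker τ ⊆ ker ρ, which in finite dimension gives ερ ≤ τ for some ε > 0: over an
-- ordered field this follows by the Gram-Schmidt process with respect to the
-- form of τ, without eigenvalues.  So ρ is a summand of τ, and ρ ∈ γ a.

module Submission where

open import Defs
open import Algebra.Bundles using (CommutativeMonoid; CommutativeRing; RawRing)
import Algebra.Properties.AbelianGroup as AbelianGroupProperties
import Algebra.Properties.CommutativeSemigroup as CommutativeSemigroupProperties
import Algebra.Properties.Ring as RingProperties
import Algebra.Properties.Semiring.Mult.TCOptimised as Mult
import Algebra.Properties.Semiring.Sum as SemiringSum
import Algebra.Solver.Ring as RingSolver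
open import Algebra.Solver.Ring.AlmostCommutativeRing
  using (_-Raw-AlmostCommutative⟶_; fromCommutativeRing)
open import Data.Bool.Base using (Bool; true; false; if_then_else_)
open import Data.Fin.Base using (Fin; zero; suc)
open import Data.Fin.Properties using () renaming (_≟_ to _≟ᶠ_)
open import Data.List.Base using (List; []; _∷_; allFin)
import Data.List.Membership.Propositional as List
open import Data.List.Membership.Propositional.Properties using (∈-allFin)
open import Data.List.Relation.Unary.All using (_∷_)
open import Data.List.Relation.Unary.AllPairs using (_∷_)
open import Data.List.Relation.Unary.Any using (here; there)
open import Data.List.Relation.Unary.Unique.Propositional using (Unique)
open import Data.Maybe.Base using (Maybe; just; nothing)
open import Data.Nat.Base as ℕ using (ℕ; _^_)
import Data.Nat.Properties as ℕ
open import Data.Product.Base using (∃-syntax; _×_; _,_; proj₁; proj₂)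
open import Data.Sum.Base using (inj₁; inj₂)
open import Function.Base using (_∘_)
open import Function.Bundles using (Equivalence; mk⇔)
open import Level using (Level; 0ℓ)
open import Relation.Binary.Bundles using (Poset)
open import Relation.Binary.Definitions using (_Respects_)
open import Relation.Binary.Morphism.Bundles using (PosetHomomorphism; mkPosetHomo)
open import Relation.Binary.PropositionalEquality.Core as ≡ using (_≡_)
import Relation.Binary.Reasoning.Setoid as SetoidReasoning
open import Relation.Binary.Structures using (IsDecTotalOrder)
open import Relation.Nullary using (yes; no)
open import Relation.Nullary.Negation using (¬_; contradiction)
open import Relation.Unary using (Pred; _∈_; _⊆_)

-- A ring solver with integer coefficients

module IntegerSolver {c ℓ : Level} (CR : CommutativeRing c ℓ) where

  open CommutativeRing CR
  open RingProperties ring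
  open AbelianGroupProperties +-abelianGroup using (⁻¹-∙-comm; ⁻¹-involutive; ε⁻¹≈ε)
  open Mult semiring using (×-homo-+; ×1-homo-*) renaming (_×_ to _×′_)
  open SetoidReasoning setoid
  open CommutativeSemigroupProperties
      (CommutativeMonoid.commutativeSemigroup +-commutativeMonoid) using (interchange)

  private
    -- Equal coefficients have to be identical for the solver to identify
    -- normal forms, hence the cancellation.
    cancel : ℕ × ℕ → ℕ × ℕ
    cancel (ℕ.suc a , ℕ.suc b) = cancel (a , b)
    cancel x                   = x

    -- (a , b) stands for the integer a - b.
    Difference : RawRing _ _
    Difference = record
      { Carrier = ℕ × ℕ
      ; _≈_ = _≡_
      ; _+_ = λ (a , b) (c , d) → cancel (a ℕ.+ c , b ℕ.+ d)
      ; _*_ = λ (a , b) (c , d) → cancel (a ℕ.* c ℕ.+ b ℕ.* d , a ℕ.* d ℕ.+ b ℕ.* c)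
      ; -_  = λ (a , b) → b , a
      ; 0#  = 0 , 0
      ; 1#  = 1 , 0
      }

    ι : ℕ → Carrier
    ι a = a ×′ 1#

    -- The first clause makes the solver's constants 0 and 1 denote 0# and 1#.
    ⟦_⟧ : ℕ × ℕ → Carrier
    ⟦ a , 0 ⟧       = ι a
    ⟦ a , ℕ.suc b ⟧ = ι a - ι (ℕ.suc b)

    ι-+ : ∀ a b → ι (a ℕ.+ b) ≈ ι a + ι b
    ι-+ = ×-homo-+ 1#

    ⟦⟧≈ : ∀ x → ⟦ x ⟧ ≈ ι (proj₁ x) - ι (proj₂ x)
    ⟦⟧≈ (a , 0)       = sym (trans (+-congˡ ε⁻¹≈ε) (+-identityʳ (ι a)))
    ⟦⟧≈ (a , ℕ.suc b) = refl

    minus-+ : ∀ a b c d → (a - b) + (c - d) ≈ (a + c) - (b + d)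
    minus-+ a b c d = trans (interchange a (- b) c (- d)) (+-congˡ (⁻¹-∙-comm b d))

    -- Serves twice: with r = 1 it undoes one step of `cancel`, and in `_≟_` it brings two
    -- differences to a common subtrahend.
    shift : ∀ p q r → p - q ≈ (p + r) - (r + q)
    shift p q r = begin
      p - q                  ≈⟨ +-identityʳ (p - q) ⟨
      (p - q) + 0#           ≈⟨ +-congˡ (-‿inverseʳ r) ⟨
      (p - q) + (r - r)      ≈⟨ minus-+ p q r r ⟩
      (p + r) - (q + r)      ≈⟨ +-congˡ (-‿cong (+-comm q r)) ⟩
      (p + r) - (r + q)      ∎

    ⟦cancel⟧≈ : ∀ x → ⟦ cancel x ⟧ ≈ ι (proj₁ x) - ι (proj₂ x)
    ⟦cancel⟧≈ x@(0       , _)       = ⟦⟧≈ x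
    ⟦cancel⟧≈ x@(ℕ.suc _ , 0)       = ⟦⟧≈ x
    ⟦cancel⟧≈ (ℕ.suc a , ℕ.suc b) = begin
      ⟦ cancel (a , b) ⟧             ≈⟨ ⟦cancel⟧≈ (a , b) ⟩
      ι a - ι b                      ≈⟨ shift (ι a) (ι b) 1# ⟩
      (ι a + 1#) - (1# + ι b)        ≈⟨ +-cong (+-comm (ι a) 1#) refl ⟩
      (1# + ι a) - (1# + ι b)        ≈⟨ +-cong (ι-+ 1 a) (-‿cong (ι-+ 1 b)) ⟨
      ι (ℕ.suc a) - ι (ℕ.suc b)      ∎

    minus-* : ∀ a b c d → (a - b) * (c - d) ≈ (a * c + b * d) - (a * d + b * c)
    minus-* a b c d = begin
      (a - b) * (c - d)                            ≈⟨ distribʳ (c - d) a (- b) ⟩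
      a * (c - d) + - b * (c - d)
        ≈⟨ +-cong (distribˡ a c (- d)) (distribˡ (- b) c (- d)) ⟩
      (a * c + a * - d) + (- b * c + - b * - d)
        ≈⟨ +-cong (+-congˡ (sym (-‿distribʳ-* a d)))
           (trans (+-cong (sym (-‿distribˡ-* b c)) bd) (+-comm _ _)) ⟩
      (a * c - a * d) + (b * d - b * c)            ≈⟨ minus-+ (a * c) (a * d) (b * d) (b * c) ⟩
      (a * c + b * d) - (a * d + b * c)            ∎
      where
      bd : - b * - d ≈ b * d
      bd = trans (sym (-‿distribˡ-* b (- d)))
             (trans (-‿cong (sym (-‿distribʳ-* b d))) (⁻¹-involutive (b * d)))

    ι-*+* : ∀ a b c d → ι (a ℕ.* b ℕ.+ c ℕ.* d) ≈ ι a * ι b + ι c * ι d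
    ι-*+* a b c d = trans (ι-+ (a ℕ.* b) (c ℕ.* d)) (+-cong (×1-homo-* a b) (×1-homo-* c d))

    homomorphism : Difference -Raw-AlmostCommutative⟶ fromCommutativeRing CR
    homomorphism = record
      { ⟦_⟧    = ⟦_⟧
      ; +-homo = λ x@(a , b) y@(c , d) → begin
          ⟦ cancel (a ℕ.+ c , b ℕ.+ d) ⟧
            ≈⟨ ⟦cancel⟧≈ (a ℕ.+ c , b ℕ.+ d) ⟩
          ι (a ℕ.+ c) - ι (b ℕ.+ d)      ≈⟨ +-cong (ι-+ a c) (-‿cong (ι-+ b d)) ⟩
          (ι a + ι c) - (ι b + ι d)      ≈⟨ minus-+ (ι a) (ι b) (ι c) (ι d) ⟨
          (ι a - ι b) + (ι c - ι d)      ≈⟨ +-cong (⟦⟧≈ x) (⟦⟧≈ y) ⟨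
          ⟦ x ⟧ + ⟦ y ⟧                  ∎
      ; *-homo = λ x@(a , b) y@(c , d) → begin
          ⟦ cancel (a ℕ.* c ℕ.+ b ℕ.* d , a ℕ.* d ℕ.+ b ℕ.* c) ⟧
            ≈⟨ ⟦cancel⟧≈ (a ℕ.* c ℕ.+ b ℕ.* d , a ℕ.* d ℕ.+ b ℕ.* c) ⟩
          ι (a ℕ.* c ℕ.+ b ℕ.* d) - ι (a ℕ.* d ℕ.+ b ℕ.* c)
            ≈⟨ +-cong (ι-*+* a c b d) (-‿cong (ι-*+* a d b c)) ⟩
          (ι a * ι c + ι b * ι d) - (ι a * ι d + ι b * ι c)
            ≈⟨ minus-* (ι a) (ι b) (ι c) (ι d) ⟨
          (ι a - ι b) * (ι c - ι d)      ≈⟨ *-cong (⟦⟧≈ x) (⟦⟧≈ y) ⟨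
          ⟦ x ⟧ * ⟦ y ⟧                  ∎
      ; -‿homo = λ x@(a , b) → begin
          ⟦ b , a ⟧          ≈⟨ ⟦⟧≈ (b , a) ⟩
          ι b - ι a          ≈⟨ +-comm (ι b) (- ι a) ⟩
          - ι a + ι b        ≈⟨ +-congˡ (⁻¹-involutive (ι b)) ⟨
          - ι a - - ι b      ≈⟨ ⁻¹-∙-comm (ι a) (- ι b) ⟩
          - (ι a - ι b)      ≈⟨ -‿cong (⟦⟧≈ x) ⟨
          - ⟦ x ⟧            ∎
      ; 0-homo = refl
      ; 1-homo = refl
      }

    -- The differences a - b and c - d are compared through a + d = c + b, so that pairs which have
    -- not been cancelled are recognised as well.
    _≟_ : ∀ x y → Maybe (⟦ x ⟧ ≈ ⟦ y ⟧)
    x@(a , b) ≟ y@(c , d) with a ℕ.+ d ℕ.≟ c ℕ.+ b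
    ... | no  _ = nothing
    ... | yes a+d≡c+b = just (begin
      ⟦ x ⟧                          ≈⟨ ⟦⟧≈ x ⟩
      ι a - ι b                      ≈⟨ shift (ι a) (ι b) (ι d) ⟩
      (ι a + ι d) - (ι d + ι b)
        ≈⟨ +-cong (trans (sym (ι-+ a d)) (trans (reflexive (≡.cong ι a+d≡c+b)) (ι-+ c b)))
           (-‿cong (+-comm (ι d) (ι b))) ⟩
      (ι c + ι b) - (ι b + ι d)      ≈⟨ shift (ι c) (ι d) (ι b) ⟨
      ι c - ι d                      ≈⟨ ⟦⟧≈ y ⟨
      ⟦ y ⟧                          ∎)

  open RingSolver Difference (fromCommutativeRing CR) homomorphism _≟_ public
    using (solve; _:=_; _:+_; _:*_; _:-_; :-_; con)

-- Inequalities and inverses in the ordered field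

module OrderedField (R : CompleteOrderedField) where

  open CompleteOrderedField R
  open IsDecTotalOrder isDecTotalOrder public
    using (_≤?_; total; antisym; ≤-respˡ-≈; ≤-respʳ-≈)
    renaming (refl to ≤-refl; trans to ≤-trans; reflexive to ≤-reflexive; _≟_ to _≈?_)
  open IntegerSolver commutativeRing public

  x≤y⇒0≤y-x : ∀ {x y} → x ≤ y → 0# ≤ y - x
  x≤y⇒0≤y-x {x} x≤y = ≤-respˡ-≈ (-‿inverseʳ x) (+-monoˡ-≤ (- x) x≤y)

  ≤-by-difference : ∀ {x y d} → 0# ≤ d → y ≈ x + d → x ≤ y
  ≤-by-difference {x} {y} {d} 0≤d y≈x+d = ≤-respʳ-≈ (trans (+-comm d x) (sym y≈x+d))
    (≤-respˡ-≈ (+-identityˡ x) (+-monoˡ-≤ x 0≤d))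

  +-mono-≤ : ∀ {w x y z} → w ≤ x → y ≤ z → w + y ≤ x + z
  +-mono-≤ {w} {x} {y} {z} w≤x y≤z = ≤-trans (+-monoˡ-≤ y w≤x)
    (≤-respˡ-≈ (+-comm y x) (≤-respʳ-≈ (+-comm z x) (+-monoˡ-≤ x y≤z)))

  +-nonneg : ∀ {x y} → 0# ≤ x → 0# ≤ y → 0# ≤ x + y
  +-nonneg 0≤x 0≤y = ≤-respˡ-≈ (+-identityˡ 0#) (+-mono-≤ 0≤x 0≤y)

  x*x-nonneg : ∀ x → 0# ≤ x * x
  x*x-nonneg x with total 0# x
  ... | inj₁ 0≤x = *-nonneg 0≤x 0≤x
  ... | inj₂ x≤0 = ≤-respʳ-≈ (solve 1 (λ x →
      (con (0 , 0) :- x) :* (con (0 , 0) :- x) := x :* x) refl x)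
                     (*-nonneg (x≤y⇒0≤y-x x≤0) (x≤y⇒0≤y-x x≤0))

  0≤1 : 0# ≤ 1#
  0≤1 = ≤-respʳ-≈ (*-identityˡ 1#) (x*x-nonneg 1#)

  0<1 : 0# < 1#
  0<1 = 0≤1 , λ 0≈1 → 1≉0 (sym 0≈1)

  0≰-1 : ¬ (0# ≤ - 1#)
  0≰-1 0≤-1 = 1≉0 (antisym (≤-by-difference 0≤-1 (sym (-‿inverseʳ 1#))) 0≤1)

  x+y≈0⇒x≈0 : ∀ {x y} → 0# ≤ x → 0# ≤ y → x + y ≈ 0# → x ≈ 0#
  x+y≈0⇒x≈0 0≤x 0≤y x+y≈0 = antisym (≤-by-difference 0≤y (sym x+y≈0)) 0≤x

  x+y≈0⇒y≈0 : ∀ {x y} → 0# ≤ x → 0# ≤ y → x + y ≈ 0# → y ≈ 0#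
  x+y≈0⇒y≈0 0≤x 0≤y x+y≈0 = x+y≈0⇒x≈0 0≤y 0≤x (trans (+-comm _ _) x+y≈0)

  x*y≈0⇒y≈0 : ∀ {x y} → ¬ (x ≈ 0#) → x * y ≈ 0# → y ≈ 0#
  x*y≈0⇒y≈0 {x} {y} x≉0 xy≈0 = let x⁻¹ , xx⁻¹≈1 = inverse x≉0 in begin
    y                ≈⟨ *-identityˡ y ⟨
    1# * y           ≈⟨ *-congʳ xx⁻¹≈1 ⟨
    x * x⁻¹ * y      ≈⟨ solve 3 (λ x y z → x :* z :* y := z :* (x :* y)) refl x y x⁻¹ ⟩
    x⁻¹ * (x * y)    ≈⟨ *-congˡ xy≈0 ⟩
    x⁻¹ * 0#         ≈⟨ zeroʳ x⁻¹ ⟩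
    0#               ∎
    where open SetoidReasoning setoid

  x*x≈0⇒x≈0 : ∀ {x} → x * x ≈ 0# → x ≈ 0#
  x*x≈0⇒x≈0 {x} xx≈0 with x ≈? 0#
  ... | yes x≈0 = x≈0
  ... | no  x≉0 = x*y≈0⇒y≈0 x≉0 xx≈0

  0<⇒≉0 : ∀ {x} → 0# < x → ¬ (x ≈ 0#)
  0<⇒≉0 (_ , 0≉x) x≈0 = 0≉x (sym x≈0)

  -- The inverse y of x cannot be nonpositive: x (0 - y) = -1 would then be a product of nonnegative
  -- elements.
  positive-inverse : ∀ {x} → 0# < x → ∃[ y ] 0# < y × x * y ≈ 1#
  positive-inverse {x} 0<x@(0≤x , _) with inverse (0<⇒≉0 0<x)
  ... | y , xy≈1 with total 0# y
  ...   | inj₁ 0≤y = y , (0≤y , 0≉y) , xy≈1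
    where
    0≉y : ¬ (0# ≈ y)
    0≉y 0≈y = 1≉0 (trans (sym xy≈1) (trans (*-congˡ (sym 0≈y)) (zeroʳ x)))
  ...   | inj₂ y≤0 = contradiction
    (≤-respʳ-≈ (trans (solve 2 (λ x y → x :* (con (0 , 0) :- y) := :- (x :* y)) refl x y)
        (-‿cong xy≈1))
      (*-nonneg 0≤x (x≤y⇒0≤y-x y≤0)))
    0≰-1

  0≤⇒0<1+ : ∀ {x} → 0# ≤ x → 0# < 1# + x
  0≤⇒0<1+ {x} 0≤x = +-nonneg 0≤1 0≤x , λ 0≈1+x → 1≉0 (x+y≈0⇒x≈0 0≤1 0≤x (sym 0≈1+x))

  -- Meant for traces: the factor has to stay positive so that scaling an operator by it preserves
  -- the kernel. It is 1 unless x is at least 1, where it can be 1/x.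
  shrink-below-1 : ∀ x → ∃[ k ] 0# < k × k * x ≤ 1#
  shrink-below-1 x with total x 1#
  ... | inj₁ x≤1 = 1# , 0<1 , ≤-respˡ-≈ (sym (*-identityˡ x)) x≤1
  ... | inj₂ 1≤x = let k , 0<k , xk≈1 = positive-inverse 0<x in
                   k , 0<k , ≤-reflexive (trans (*-comm k x) xk≈1)
    where
    0<x : 0# < x
    0<x = ≤-trans 0≤1 1≤x , λ 0≈x → 1≉0 (antisym (≤-respʳ-≈ (sym 0≈x) 1≤x) 0≤1)

module Vectors (R : CompleteOrderedField) (n : ℕ) where

  open Quantum R n

  private
    module R = CompleteOrderedField R
    module ℂ = CommutativeRing ℂ-commutativeRing
    module ℂS = IntegerSolver ℂ-commutativeRing
    module ℂSum = SemiringSum ℂ.semiring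

  open OrderedField R
  open RingProperties R.ring using (-‿involutive; -‿+-comm)

  -- Conjugation and modulus of complex numbers

  re-fromReal-* : ∀ k z → re (fromReal k ℂ.* z) R.≈ k R.* re z
  re-fromReal-* k (a , b) = solve 3 (λ k a b → k :* a :- con (0 , 0) :* b := k :* a) R.refl k a b

  im-fromReal-* : ∀ k z → im (fromReal k ℂ.* z) R.≈ k R.* im z
  im-fromReal-* k (a , b) = solve 3 (λ k a b → k :* b :+ con (0 , 0) :* a := k :* b) R.refl k a b

  conj-cong : ∀ {y z} → y ℂ.≈ z → conj y ℂ.≈ conj z
  conj-cong (p , q) = p , R.-‿cong q

  conj-involutive : ∀ z → conj (conj z) ℂ.≈ z
  conj-involutive (a , b) = R.refl , -‿involutive b

  conj-+ : ∀ y z → conj (y ℂ.+ z) ℂ.≈ conj y ℂ.+ conj z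
  conj-+ (a , b) (c , d) = R.refl , R.sym (-‿+-comm b d)

  conj-* : ∀ y z → conj (y ℂ.* z) ℂ.≈ conj y ℂ.* conj z
  conj-* (a , b) (c , d) =
    solve 4 (λ a b c d → a :* c :- b :* d := a :* c :- (:- b) :* (:- d)) R.refl a b c d ,
    solve 4 (λ a b c d → :- (a :* d :+ b :* c) := a :* (:- d) :+ (:- b) :* c) R.refl a b c d

  conj-0 : conj ℂ.0# ℂ.≈ ℂ.0#
  conj-0 = R.refl , solve 0 (:- con (0 , 0) := con (0 , 0)) R.refl

  conj≈0⇒≈0 : ∀ {z} → conj z ℂ.≈ ℂ.0# → z ℂ.≈ ℂ.0#
  conj≈0⇒≈0 {z} z̄≈0 = ℂ.trans (ℂ.sym (conj-involutive z)) (ℂ.trans (conj-cong z̄≈0) conj-0)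

  conj-fromReal : ∀ k → conj (fromReal k) ℂ.≈ fromReal k
  conj-fromReal k = R.refl , proj₂ conj-0

  conj-*-self-re : ∀ z → re (conj z ℂ.* z) R.≈ re z R.* re z R.+ im z R.* im z
  conj-*-self-re (a , b) = solve 2 (λ a b → a :* a :- (:- b) :* b := a :* a :+ b :* b) R.refl a b

  ∣z∣²-nonneg : ∀ z → R.0# R.≤ re (conj z ℂ.* z)
  ∣z∣²-nonneg z = ≤-respʳ-≈ (R.sym (conj-*-self-re z))
      (+-nonneg (x*x-nonneg (re z)) (x*x-nonneg (im z)))

  ∣z∣²≈0⇒z≈0 : ∀ {z} → re (conj z ℂ.* z) R.≈ R.0# → z ℂ.≈ ℂ.0#
  ∣z∣²≈0⇒z≈0 {z} ∣z∣²≈0 =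
    x*x≈0⇒x≈0 (x+y≈0⇒x≈0 (x*x-nonneg (re z)) (x*x-nonneg (im z)) sq) ,
    x*x≈0⇒x≈0 (x+y≈0⇒y≈0 (x*x-nonneg (re z)) (x*x-nonneg (im z)) sq)
    where
    sq = R.trans (R.sym (conj-*-self-re z)) ∣z∣²≈0

  -- Sums

  conj-sum : ∀ {m} (f : Fin m → ℂ) → conj (ℂSum.sum f) ℂ.≈ ℂSum.sum (conj ∘ f)
  conj-sum {ℕ.zero}  f = conj-0
  conj-sum {ℕ.suc m} f = ℂ.trans (conj-+ (f zero) (ℂSum.sum (f ∘ suc)))
      (ℂ.+-congˡ (conj-sum (f ∘ suc)))

  re-sum-nonneg : ∀ {m} (f : Fin m → ℂ) → (∀ i → R.0# R.≤ re (f i)) → R.0# R.≤ re (ℂSum.sum f)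
  re-sum-nonneg {ℕ.zero}  f 0≤f = ≤-refl
  re-sum-nonneg {ℕ.suc m} f 0≤f = +-nonneg (0≤f zero) (re-sum-nonneg (f ∘ suc) (λ i → 0≤f (suc i)))

  re-sum≈0 : ∀ {m} (f : Fin m → ℂ) → (∀ i → R.0# R.≤ re (f i)) → re (ℂSum.sum f) R.≈ R.0# →
      ∀ i → re (f i) R.≈ R.0#
  re-sum≈0 {ℕ.suc m} f 0≤f Σf≈0 zero = x+y≈0⇒x≈0 (0≤f zero)
      (re-sum-nonneg (f ∘ suc) (λ i → 0≤f (suc i))) Σf≈0
  re-sum≈0 {ℕ.suc m} f 0≤f Σf≈0 (suc i) = re-sum≈0 (f ∘ suc) (λ i → 0≤f (suc i))
    (x+y≈0⇒y≈0 (0≤f zero) (re-sum-nonneg (f ∘ suc) (λ i → 0≤f (suc i))) Σf≈0) i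

  -- The bilinear pairing of vectors and the inner product

  infix 7 _∙_
  -- Without conjugation, so that it covers two cases by definition: ⟨u|v⟩ is `(conj ∘ u) ∙ v`, and
  -- entry i of `M ⟨$⟩ v` is `M i ∙ v`. The laws below are applied to both.
  _∙_ : ℋ → ℋ → ℂ
  a ∙ v = ℂSum.sum (λ i → a i ℂ.* v i)

  ∙-congˡ : ∀ a {v w} → v ≈ᵥ w → a ∙ v ℂ.≈ a ∙ w
  ∙-congˡ a v≈w = ℂSum.sum-cong-≋ (λ i → ℂ.*-congˡ (v≈w i))

  ∙-congʳ : ∀ {a b} v → a ≈ᵥ b → a ∙ v ℂ.≈ b ∙ v
  ∙-congʳ v a≈b = ℂSum.sum-cong-≋ (λ i → ℂ.*-congʳ (a≈b i))

  ∙-comm : ∀ a v → a ∙ v ℂ.≈ v ∙ a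
  ∙-comm a v = ℂSum.sum-cong-≋ (λ i → ℂ.*-comm (a i) (v i))

  ∙-+ʳ : ∀ a v w → a ∙ (v +ᵥ w) ℂ.≈ a ∙ v ℂ.+ a ∙ w
  ∙-+ʳ a v w = ℂ.trans (ℂSum.sum-cong-≋ (λ i → ℂ.distribˡ (a i) (v i) (w i)))
    (ℂSum.∑-distrib-+ (λ i → a i ℂ.* v i) (λ i → a i ℂ.* w i))

  ∙-·ʳ : ∀ a z v → a ∙ (z ·ᵥ v) ℂ.≈ z ℂ.* (a ∙ v)
  ∙-·ʳ a z v = ℂ.trans
    (ℂSum.sum-cong-≋ λ i → ℂS.solve 3 (λ a z v → a ℂS.:* (z ℂS.:* v) ℂS.:=
        z ℂS.:* (a ℂS.:* v)) ℂ.refl (a i) z (v i))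
    (ℂ.sym (ℂSum.*-distribˡ-sum z (λ i → a i ℂ.* v i)))

  ∙-zeroʳ : ∀ a → a ∙ 0ᵥ ℂ.≈ ℂ.0#
  ∙-zeroʳ a = ℂ.trans (ℂ.sym (ℂSum.*-distribʳ-sum ℂ.0# a)) (ℂ.zeroʳ _)

  ∙-+ˡ : ∀ a b v → (a +ᵥ b) ∙ v ℂ.≈ a ∙ v ℂ.+ b ∙ v
  ∙-+ˡ a b v = ℂ.trans (∙-comm (a +ᵥ b) v) (ℂ.trans (∙-+ʳ v a b)
      (ℂ.+-cong (∙-comm v a) (∙-comm v b)))

  ∙-·ˡ : ∀ z a v → (z ·ᵥ a) ∙ v ℂ.≈ z ℂ.* (a ∙ v)
  ∙-·ˡ z a v = ℂ.trans (∙-comm (z ·ᵥ a) v) (ℂ.trans (∙-·ʳ v z a) (ℂ.*-congˡ (∙-comm v a)))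

  conj-∙ : ∀ a v → conj (a ∙ v) ℂ.≈ (conj ∘ a) ∙ (conj ∘ v)
  conj-∙ a v = ℂ.trans (conj-sum (λ i → a i ℂ.* v i)) (ℂSum.sum-cong-≋ (λ i → conj-* (a i) (v i)))

  ⟨∣⟩-conj : ∀ u v → ⟨ u ∣ v ⟩ ℂ.≈ conj ⟨ v ∣ u ⟩
  ⟨∣⟩-conj u v = ℂ.sym (ℂ.trans (conj-∙ (conj ∘ v) u)
    (ℂ.trans (∙-congʳ (conj ∘ u) (λ i → conj-involutive (v i))) (∙-comm v (conj ∘ u))))

  ⟨∣⟩-orthogonal-sym : ∀ u v → ⟨ u ∣ v ⟩ ℂ.≈ ℂ.0# → ⟨ v ∣ u ⟩ ℂ.≈ ℂ.0#
  ⟨∣⟩-orthogonal-sym u v u⊥v = conj≈0⇒≈0 (ℂ.trans (ℂ.sym (⟨∣⟩-conj u v)) u⊥v)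

  ⟨v∣v⟩≈0⇒v≈0 : ∀ v → re ⟨ v ∣ v ⟩ R.≈ R.0# → v ≈ᵥ 0ᵥ
  ⟨v∣v⟩≈0⇒v≈0 v vv≈0 i = ∣z∣²≈0⇒z≈0 (re-sum≈0 (λ i → conj (v i) ℂ.* v i)
      (λ i → ∣z∣²-nonneg (v i)) vv≈0 i)

  -- Columns of self-adjoint operators

  column : Operator → Basis → ℋ
  column M j i = M i j

  -- Self-adjointness makes column j the conjugate of row j. Hence u is orthogonal to all columns
  -- exactly when it lies in the kernel of M.
  ⟨∣column⟩ : ∀ {M} → IsSelfAdjoint M → ∀ u j → ⟨ u ∣ column M j ⟩ ℂ.≈ conj ((M ⟨$⟩ u) j)
  ⟨∣column⟩ {M} M†≈M u j = ℂ.trans (∙-comm (conj ∘ u) (column M j))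
    (ℂ.trans (∙-congʳ (conj ∘ u) (λ i → M†≈M i j)) (ℂ.sym (conj-∙ (M j) u)))

  -- Exchanging the two sums exposes the inner products of u with the columns of M, which are the
  -- conjugated entries of M u.
  adjoint : ∀ {M} → IsSelfAdjoint M → ∀ u v → ⟨ u ∣ M ⟨$⟩ v ⟩ ℂ.≈ ⟨ M ⟨$⟩ u ∣ v ⟩
  adjoint {M} M†≈M u v = begin
    ℂSum.sum (λ i → conj (u i) ℂ.* ℂSum.sum (λ j → M i j ℂ.* v j))
      ≈⟨ ℂSum.sum-cong-≋ (λ i → ℂSum.*-distribˡ-sum (conj (u i)) (λ j → M i j ℂ.* v j)) ⟩
    ℂSum.sum (λ i → ℂSum.sum (λ j → conj (u i) ℂ.* (M i j ℂ.* v j)))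
      ≈⟨ ℂSum.∑-comm (λ i j → conj (u i) ℂ.* (M i j ℂ.* v j)) ⟩
    ℂSum.sum (λ j → ℂSum.sum (λ i → conj (u i) ℂ.* (M i j ℂ.* v j)))
      ≈⟨ ℂSum.sum-cong-≋ (λ j → ℂSum.sum-cong-≋ (λ i → ℂ.*-assoc (conj (u i)) (M i j) (v j))) ⟨
    ℂSum.sum (λ j → ℂSum.sum (λ i → conj (u i) ℂ.* M i j ℂ.* v j))
      ≈⟨ ℂSum.sum-cong-≋ (λ j → ℂSum.*-distribʳ-sum (v j) (λ i → conj (u i) ℂ.* M i j)) ⟨
    ℂSum.sum (λ j → ⟨ u ∣ column M j ⟩ ℂ.* v j)
      ≈⟨ ∙-congʳ v (⟨∣column⟩ {M} M†≈M u) ⟩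
    ⟨ M ⟨$⟩ u ∣ v ⟩ ∎
    where open SetoidReasoning ℂ.setoid

  -- Real multiples and real bilinear forms

  infixr 7 _·ᵣ_

  -- Given by components, so that identities between real combinations of vectors split into two
  -- identities in R for the solver.
  _·ᵣ_ : R.Carrier → ℋ → ℋ
  (s ·ᵣ v) i = s R.* re (v i) , s R.* im (v i)

  ·ᵣ≈·ᵥ : ∀ s v → s ·ᵣ v ≈ᵥ fromReal s ·ᵥ v
  ·ᵣ≈·ᵥ s v i = R.sym (re-fromReal-* s (v i)) , R.sym (im-fromReal-* s (v i))

  -- Here ℋ is regarded as a real vector space: for self-adjoint M the real part is a symmetric
  -- bilinear form, and on the diagonal it loses nothing because ⟨v|M|v⟩ is real.
  form : Operator → ℋ → ℋ → R.Carrier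
  form M u v = re ⟨ u ∣ M ⟨$⟩ v ⟩

  record PositiveForm (B : ℋ → ℋ → R.Carrier) : Set where
    field
      congʳ  : ∀ u {v w} → v ≈ᵥ w → B u v R.≈ B u w
      +ʳ     : ∀ u v w → B u (v +ᵥ w) R.≈ B u v R.+ B u w
      ·ʳ     : ∀ u s v → B u (s ·ᵣ v) R.≈ s R.* B u v
      sym    : ∀ u v → B u v R.≈ B v u
      nonneg : ∀ v → R.0# R.≤ B v v

    open SetoidReasoning R.setoid

    congˡ : ∀ {u v} w → u ≈ᵥ v → B u w R.≈ B v w
    congˡ {u} {v} w u≈v = R.trans (sym u w) (R.trans (congʳ w u≈v) (sym w v))

    combʳ : ∀ u s v w → B u (s ·ᵣ v +ᵥ w) R.≈ s R.* B u v R.+ B u w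
    combʳ u s v w = R.trans (+ʳ u (s ·ᵣ v) w) (R.+-congʳ (·ʳ u s v))

    combˡ : ∀ s u v w → B (s ·ᵣ u +ᵥ v) w R.≈ s R.* B u w R.+ B v w
    combˡ s u v w = R.trans (sym (s ·ᵣ u +ᵥ v) w)
      (R.trans (combʳ w s u v) (R.+-cong (R.*-congˡ (sym w u)) (sym w v)))

    quadratic : ∀ s v w → B (s ·ᵣ v +ᵥ w) (s ·ᵣ v +ᵥ w) R.≈
      s R.* s R.* B v v R.+ (s R.* B v w R.+ s R.* B v w) R.+ B w w
    quadratic s v w = begin
      B (s ·ᵣ v +ᵥ w) (s ·ᵣ v +ᵥ w)
        ≈⟨ combˡ s v w (s ·ᵣ v +ᵥ w) ⟩
      s R.* B v (s ·ᵣ v +ᵥ w) R.+ B w (s ·ᵣ v +ᵥ w)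
        ≈⟨ R.+-cong (R.*-congˡ (combʳ v s v w))
           (R.trans (combʳ w s v w) (R.+-congʳ (R.*-congˡ (sym w v)))) ⟩
      s R.* (s R.* B v v R.+ B v w) R.+ (s R.* B v w R.+ B w w)
        ≈⟨ solve 4 (λ s p q r → s :* (s :* p :+ q) :+ (s :* q :+ r) :=
           s :* s :* p :+ (s :* q :+ s :* q) :+ r) R.refl s (B v v) (B v w) (B w w) ⟩
      s R.* s R.* B v v R.+ (s R.* B v w R.+ s R.* B v w) R.+ B w w ∎

    -- B v w ≠ 0 would make the quadratic s ↦ B (s v + w) (s v + w) negative
    -- at s = -(B w w + 1) / B v w.
    isotropic⇒orthogonal : ∀ {v} → B v v R.≈ R.0# → ∀ w → B v w R.≈ R.0#
    isotropic⇒orthogonal {v} vv≈0 w with B v w ≈? R.0#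
    ... | yes vw≈0 = vw≈0
    ... | no  vw≉0 = contradiction (≤-respʳ-≈ value
        (+-nonneg (nonneg (s ·ᵣ v +ᵥ w)) (+-nonneg (nonneg w) 0≤1))) 0≰-1
      where
      b = B v w
      q = B w w
      i = proj₁ (R.inverse vw≉0)
      s = R.- ((q R.+ R.1#) R.* i)

      sb≈ : s R.* b R.≈ R.- (q R.+ R.1#)
      sb≈ = begin
        s R.* b
          ≈⟨ solve 3 (λ q b i → (:- ((q :+ con (1 , 0)) :* i)) :* b :=
             :- ((q :+ con (1 , 0)) :* (b :* i))) R.refl q b i ⟩
        R.- ((q R.+ R.1#) R.* (b R.* i))        ≈⟨ R.-‿cong (R.*-congˡ (proj₂ (R.inverse vw≉0))) ⟩
        R.- ((q R.+ R.1#) R.* R.1#)             ≈⟨ R.-‿cong (R.*-identityʳ _) ⟩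
        R.- (q R.+ R.1#)                        ∎

      value : B (s ·ᵣ v +ᵥ w) (s ·ᵣ v +ᵥ w) R.+ (q R.+ R.1#) R.≈ R.- R.1#
      value = begin
        B (s ·ᵣ v +ᵥ w) (s ·ᵣ v +ᵥ w) R.+ (q R.+ R.1#)
          ≈⟨ R.+-congʳ (quadratic s v w) ⟩
        s R.* s R.* B v v R.+ (s R.* b R.+ s R.* b) R.+ q R.+ (q R.+ R.1#)
          ≈⟨ R.+-congʳ (R.+-congʳ (R.+-cong (R.*-congˡ vv≈0) (R.+-cong sb≈ sb≈))) ⟩
        s R.* s R.* R.0# R.+ (R.- (q R.+ R.1#) R.+ R.- (q R.+ R.1#)) R.+ q R.+ (q R.+ R.1#)
          ≈⟨ solve 2 (λ s q → s :* s :* con (0 , 0) :+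
             (:- (q :+ con (1 , 0)) :+ :- (q :+ con (1 , 0))) :+ q :+ (q :+ con (1 , 0)) :=
                 :- con (1 , 0)) R.refl s q ⟩
        R.- R.1# ∎

  form-positive : ∀ {M} → IsPositive M → PositiveForm (form M)
  form-positive {M} (M†≈M , 0≤M) = record
    { congʳ  = λ u v≈w → proj₁ (∙-congˡ (conj ∘ u) (λ i → ∙-congˡ (M i) v≈w))
    ; +ʳ     = λ u v w → proj₁ (ℂ.trans (∙-congˡ (conj ∘ u) (λ i → ∙-+ʳ (M i) v w))
                                  (∙-+ʳ (conj ∘ u) (M ⟨$⟩ v) (M ⟨$⟩ w)))
    ; ·ʳ     = λ u s v → R.trans
        (proj₁ (ℂ.trans (∙-congˡ (conj ∘ u) (λ i → ℂ.trans (∙-congˡ (M i) (·ᵣ≈·ᵥ s v))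
            (∙-·ʳ (M i) (fromReal s) v)))
                        (∙-·ʳ (conj ∘ u) (fromReal s) (M ⟨$⟩ v))))
        (re-fromReal-* s ⟨ u ∣ M ⟨$⟩ v ⟩)
    ; sym    = λ u v → proj₁ (ℂ.trans (adjoint {M} M†≈M u v) (⟨∣⟩-conj (M ⟨$⟩ u) v))
    ; nonneg = 0≤M
    }

  -- An isotropic v is orthogonal, for the form of M, to every vector and so to M v. Moving M to the
  -- left turns this into ⟨Mv|Mv⟩ = 0.
  isotropic⇒kernel : ∀ {M} → IsPositive M → ∀ {v} → form M v v R.≈ R.0# → v ∈ kernel M
  isotropic⇒kernel {M} M≥0@(M†≈M , _) {v} vMv≈0 = ⟨v∣v⟩≈0⇒v≈0 (M ⟨$⟩ v)
    (R.trans (R.sym (proj₁ (adjoint {M} M†≈M v (M ⟨$⟩ v))))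
      (PositiveForm.isotropic⇒orthogonal (form-positive {M} M≥0) {v} vMv≈0 (M ⟨$⟩ v)))

  kernel⇒isotropic : ∀ M {v} → v ∈ kernel M → form M v v R.≈ R.0#
  kernel⇒isotropic M {v} Mv≈0 = proj₁ (ℂ.trans (∙-congˡ (conj ∘ v) Mv≈0) (∙-zeroʳ (conj ∘ v)))

  -- Domination of one positive form by another

  module Domination
    {B D : ℋ → ℋ → R.Carrier} (B-positive : PositiveForm B) (D-positive : PositiveForm D)
    (isotropic-⊆ : ∀ {v} → B v v R.≈ R.0# → D v v R.≈ R.0#) where

    private
      module B = PositiveForm B-positive
      module D = PositiveForm D-positive
      open SetoidReasoning R.setoid

    -- The invariant of the Gram-Schmidt process. In `project`, p is a B-orthogonal projection of v
    -- to P, specified only by its products with P because B may be degenerate there.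
    record IsControlled (P : Pred ℋ 0ℓ) : Set where
      field
        resp-≈      : P Respects _≈ᵥ_
        comb-closed : ∀ s {u v} → u ∈ P → v ∈ P → s ·ᵣ u +ᵥ v ∈ P
        project     : ∀ v → ∃[ p ] p ∈ P × (∀ {y} → y ∈ P → B p y R.≈ B v y)
        bound       : ∃[ C ] R.0# R.≤ C × (∀ {x} → x ∈ P → D x x R.≤ C R.* B x x)

    trivial-controlled : IsControlled (_≈ᵥ 0ᵥ)
    trivial-controlled = record
      { resp-≈      = λ u≈v u≈0 i → ℂ.trans (ℂ.sym (u≈v i)) (u≈0 i)
      ; comb-closed = λ s u≈0 v≈0 i →
          R.trans (R.+-cong (R.*-congˡ (proj₁ (u≈0 i))) (proj₁ (v≈0 i))) (s*0+0≈0 s) ,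
          R.trans (R.+-cong (R.*-congˡ (proj₂ (u≈0 i))) (proj₂ (v≈0 i))) (s*0+0≈0 s)
      ; project     = λ v → 0ᵥ , (λ _ → ℂ.refl) , λ y≈0 →
          R.trans (zeroʳ B-positive 0ᵥ y≈0) (R.sym (zeroʳ B-positive v y≈0))
      ; bound       = R.0# , ≤-refl , λ {x} x≈0 →
          ≤-reflexive (R.trans (zeroʳ D-positive x x≈0) (R.sym (R.zeroˡ _)))
      }
      where
      s*0+0≈0 : ∀ s → s R.* R.0# R.+ R.0# R.≈ R.0#
      s*0+0≈0 s = R.trans (R.+-identityʳ _) (R.zeroʳ s)

      zeroʳ : ∀ {F} → PositiveForm F → ∀ u {v} → v ≈ᵥ 0ᵥ → F u v R.≈ R.0#
      zeroʳ {F} F-positive u {v} v≈0 = begin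
        F u v               ≈⟨ F.congʳ u v≈0 ⟩
        F u 0ᵥ              ≈⟨ F.congʳ u (λ i → R.sym (R.zeroˡ R.0#) , R.sym (R.zeroˡ R.0#)) ⟩
        F u (R.0# ·ᵣ 0ᵥ)    ≈⟨ F.·ʳ u R.0# 0ᵥ ⟩
        R.0# R.* F u 0ᵥ     ≈⟨ R.zeroˡ _ ⟩
        R.0#                ∎
        where module F = PositiveForm F-positive

    -- One step of the Gram-Schmidt process with respect to B: f is the
    -- component of e that is B-orthogonal to P.
    module _ {P : Pred ℋ 0ℓ} (P-controlled : IsControlled P) (e : ℋ) where

      open IsControlled P-controlled

      private
        p f : ℋ
        p = proj₁ (project e)
        f = (R.- R.1#) ·ᵣ p +ᵥ e

        p∈P : p ∈ P
        p∈P = proj₁ (proj₂ (project e))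

        f⊥P : ∀ {y} → y ∈ P → B f y R.≈ R.0#
        f⊥P {y} y∈P = begin
          B f y                                ≈⟨ B.combˡ (R.- R.1#) p e y ⟩
          (R.- R.1#) R.* B p y R.+ B e y
            ≈⟨ R.+-congʳ (R.*-congˡ (proj₂ (proj₂ (project e)) y∈P)) ⟩
          (R.- R.1#) R.* B e y R.+ B e y
            ≈⟨ solve 1 (λ b → (:- con (1 , 0)) :* b :+ b := con (0 , 0)) R.refl (B e y) ⟩
          R.0#                                 ∎

        -- The coordinate of v along f is B v f / B f f. If f is isotropic then B v f is zero too,
        -- and 0 serves.
        coefficient : ∀ v → ∃[ t ] t R.* B f f R.≈ B v f
        coefficient v with B f f ≈? R.0#
        ... | yes ff≈0 = R.0# , R.trans (R.zeroˡ _)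
            (R.sym (R.trans (B.sym v f) (B.isotropic⇒orthogonal ff≈0 v)))
        ... | no  ff≉0 = let i , ff*i≈1 = R.inverse ff≉0 in B v f R.* i , (begin
          B v f R.* i R.* B f f
            ≈⟨ solve 3 (λ b i q → b :* i :* q := b :* (q :* i)) R.refl (B v f) i (B f f) ⟩
          B v f R.* (B f f R.* i)    ≈⟨ R.*-congˡ ff*i≈1 ⟩
          B v f R.* R.1#             ≈⟨ R.*-identityʳ _ ⟩
          B v f                      ∎)

        -- E is D f f / B f f. When the denominator is zero, `isotropic-⊆` makes the numerator zero
        -- as well; this is where the kernels of the two forms are compared.
        bound-f : ∃[ E ] R.0# R.≤ E × D f f R.≤ E R.* B f f
        bound-f with B f f ≈? R.0#
        ... | yes ff≈0 = R.0# , ≤-refl , ≤-reflexive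
            (R.trans (isotropic-⊆ ff≈0) (R.sym (R.zeroˡ _)))
        ... | no  ff≉0 = let i , (0≤i , _) , ff*i≈1 = positive-inverse
                               (B.nonneg f , λ 0≈ff → ff≉0 (R.sym 0≈ff)) in
          D f f R.* i , R.*-nonneg (D.nonneg f) 0≤i , ≤-reflexive (R.sym (begin
            D f f R.* i R.* B f f
              ≈⟨ solve 3 (λ b i q → b :* i :* q := b :* (q :* i)) R.refl (D f f) i (B f f) ⟩
            D f f R.* (B f f R.* i)    ≈⟨ R.*-congˡ ff*i≈1 ⟩
            D f f R.* R.1#             ≈⟨ R.*-identityʳ _ ⟩
            D f f                      ∎))

      Extension : Pred ℋ 0ℓ
      Extension x = ∃[ s ] ∃[ y ] y ∈ P × x ≈ᵥ s ·ᵣ f +ᵥ y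

      -- Adjoining f also adjoins e, since the component p taken away from e lies in P.
      extension-comb : ∀ s {y} → y ∈ P → s ·ᵣ e +ᵥ y ∈ Extension
      extension-comb s {y} y∈P = s , s ·ᵣ p +ᵥ y , comb-closed s p∈P y∈P , λ i →
        law (re (e i)) (re (p i)) (re (y i)) , law (im (e i)) (im (p i)) (im (y i))
        where
        law : ∀ e p y → s R.* e R.+ y R.≈ s R.* ((R.- R.1#) R.* p R.+ e) R.+ (s R.* p R.+ y)
        law = solve 4 (λ s e p y → s :* e :+ y :=
            s :* ((:- con (1 , 0)) :* p :+ e) :+ (s :* p :+ y)) R.refl s

      private
        extension-closed : ∀ s {u v} → u ∈ Extension → v ∈ Extension → s ·ᵣ u +ᵥ v ∈ Extension
        extension-closed s {u} {v} (a , y , y∈P , u≈) (b , z , z∈P , v≈) =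
          s R.* a R.+ b , s ·ᵣ y +ᵥ z , comb-closed s y∈P z∈P , λ i →
            R.trans (R.+-cong (R.*-congˡ (proj₁ (u≈ i))) (proj₁ (v≈ i)))
                (law (re (f i)) (re (y i)) (re (z i))) ,
            R.trans (R.+-cong (R.*-congˡ (proj₂ (u≈ i))) (proj₂ (v≈ i)))
                (law (im (f i)) (im (y i)) (im (z i)))
          where
          law : ∀ f y z → s R.* (a R.* f R.+ y) R.+ (b R.* f R.+ z) R.≈
                          (s R.* a R.+ b) R.* f R.+ (s R.* y R.+ z)
          law = solve 6 (λ s a b f y z → s :* (a :* f :+ y) :+ (b :* f :+ z) :=
                                         (s :* a :+ b) :* f :+ (s :* y :+ z)) R.refl s a b

        -- As f is B-orthogonal to P, the projections of v along f and to P simply add up.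
        extension-project : ∀ v → ∃[ q ] q ∈ Extension × (∀ {x} → x ∈ Extension → B q x R.≈ B v x)
        extension-project v = t ·ᵣ f +ᵥ r , (t , r , r∈P , λ _ → ℂ.refl) ,
          λ {x} (s , y , y∈P , x≈) → begin
            B (t ·ᵣ f +ᵥ r) x
              ≈⟨ B.combˡ t f r x ⟩
            t R.* B f x R.+ B r x
              ≈⟨ R.+-cong (R.*-congˡ (expand f s y x≈)) (expand r s y x≈) ⟩
            t R.* (s R.* B f f R.+ B f y) R.+ (s R.* B r f R.+ B r y)
              ≈⟨ R.+-cong (R.*-congˡ (R.+-congˡ (f⊥P y∈P)))
                   (R.+-cong (R.*-congˡ (R.trans (B.sym r f) (f⊥P r∈P))) (r≈v y∈P)) ⟩
            t R.* (s R.* B f f R.+ R.0#) R.+ (s R.* R.0# R.+ B v y)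
              ≈⟨ solve 4 (λ t s q b → t :* (s :* q :+ con (0 , 0)) :+ (s :* con (0 , 0) :+ b) :=
                 s :* (t :* q) :+ b)
                   R.refl t s (B f f) (B v y) ⟩
            s R.* (t R.* B f f) R.+ B v y
              ≈⟨ R.+-congʳ (R.*-congˡ tff≈vf) ⟩
            s R.* B v f R.+ B v y
              ≈⟨ expand v s y x≈ ⟨
            B v x ∎
          where
          t = proj₁ (coefficient v)
          tff≈vf = proj₂ (coefficient v)
          r = proj₁ (project v)
          r∈P = proj₁ (proj₂ (project v))
          r≈v = proj₂ (proj₂ (project v))

          expand : ∀ u s y {x} → x ≈ᵥ s ·ᵣ f +ᵥ y → B u x R.≈ s R.* B u f R.+ B u y
          expand u s y x≈ = R.trans (B.congʳ u x≈) (B.combʳ u s f y)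

        -- D (s f + y) ≤ 2 s² D f + 2 D y, the difference being D (s f - y).
        extension-bound : ∃[ C ] R.0# R.≤ C × (∀ {x} → x ∈ Extension → D x x R.≤ C R.* B x x)
        extension-bound = let C , 0≤C , D≤CB = bound ; E , 0≤E , Dff≤EBff = bound-f in
          (R.1# R.+ R.1#) R.* (C R.+ E) , R.*-nonneg (+-nonneg 0≤1 0≤1) (+-nonneg 0≤C 0≤E) ,
          λ {x} (s , y , y∈P , x≈) → ≤-by-difference
            (+-nonneg (D.nonneg ((R.- s) ·ᵣ f +ᵥ y))
              (R.*-nonneg (+-nonneg 0≤1 0≤1)
                (+-nonneg (+-nonneg (R.*-nonneg (x*x-nonneg s) (x≤y⇒0≤y-x Dff≤EBff))
                    (x≤y⇒0≤y-x (D≤CB y∈P)))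
                  -- The constant C + E multiplies both B f f and B y y; these are the two products
                  -- that the bounds on D f f and D y y leave over.
                  (+-nonneg (R.*-nonneg 0≤C (R.*-nonneg (x*x-nonneg s) (B.nonneg f)))
                    (R.*-nonneg 0≤E (B.nonneg y))))))
            (begin
              (R.1# R.+ R.1#) R.* (C R.+ E) R.* B x x
                ≈⟨ R.*-congˡ (R.trans (B.congʳ x x≈) (R.trans (B.congˡ (s ·ᵣ f +ᵥ y) x≈)
                     (R.trans (B.quadratic s f y)
                         (R.+-congʳ (R.+-congˡ
                             (R.+-cong (R.*-congˡ (f⊥P y∈P)) (R.*-congˡ (f⊥P y∈P)))))))) ⟩
              (R.1# R.+ R.1#) R.* (C R.+ E) R.*
                  (s R.* s R.* B f f R.+ (s R.* R.0# R.+ s R.* R.0#) R.+ B y y)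
                ≈⟨ solve 8 (λ C E s bf by df dm dy →
                     (con (2 , 0) :* (C :+ E)) :*
                         (s :* s :* bf :+ (s :* con (0 , 0) :+ s :* con (0 , 0)) :+ by) :=
                     (s :* s :* df :+ (s :* dm :+ s :* dm) :+ dy) :+
                     (((:- s) :* (:- s) :* df :+ ((:- s) :* dm :+ (:- s) :* dm) :+ dy) :+
                      con (2 , 0) :* ((s :* s :* (E :* bf :- df) :+ (C :* by :- dy)) :+
                          (C :* (s :* s :* bf) :+ E :* by))))
                     R.refl C E s (B f f) (B y y) (D f f) (D f y) (D y y) ⟩
              (s R.* s R.* D f f R.+ (s R.* D f y R.+ s R.* D f y) R.+ D y y) R.+ _
                ≈⟨ R.+-cong (R.trans (D.congʳ x x≈)
                   (R.trans (D.congˡ (s ·ᵣ f +ᵥ y) x≈) (D.quadratic s f y)))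
                     (R.+-congʳ (D.quadratic (R.- s) f y)) ⟨
              D x x R.+ _ ∎)

      extension-controlled : IsControlled Extension
      extension-controlled = record
        { resp-≈      = λ x≈x′ (s , y , y∈P , x≈) → s , y , y∈P , λ i →
            ℂ.trans (ℂ.sym (x≈x′ i)) (x≈ i)
        ; comb-closed = extension-closed
        ; project     = extension-project
        ; bound       = extension-bound
        }

    -- Exhausting the space coordinate by coordinate

    SupportedOn : List Basis → Pred ℋ 0ℓ
    SupportedOn L x = ∀ k → ¬ k List.∈ L → x k ℂ.≈ ℂ.0#

    private
      unit : ℂ → Basis → ℋ
      unit z j k with k ≟ᶠ j
      ... | yes _ = z
      ... | no  _ = ℂ.0#

      erase : Basis → ℋ → ℋ
      erase j x k with k ≟ᶠ j
      ... | yes _ = ℂ.0#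
      ... | no  _ = x k

      i# : ℂ
      i# = R.0# , R.1#

      decompose : ∀ j x → x ≈ᵥ re (x j) ·ᵣ unit ℂ.1# j +ᵥ (im (x j) ·ᵣ unit i# j +ᵥ erase j x)
      decompose j x k with k ≟ᶠ j
      ... | yes ≡.refl =
        solve 2 (λ a b → a := a :* con (1 , 0) :+ (b :* con (0 , 0) :+ con (0 , 0))) R.refl
            (re (x k)) (im (x k)) ,
        solve 2 (λ a b → b := a :* con (0 , 0) :+ (b :* con (1 , 0) :+ con (0 , 0))) R.refl
            (re (x k)) (im (x k))
      ... | no  _ = law (re (x k)) , law (im (x k))
        where
        law : ∀ c → c R.≈ re (x j) R.* R.0# R.+ (im (x j) R.* R.0# R.+ c)
        law = solve 3 (λ a b c → c := a :* con (0 , 0) :+ (b :* con (0 , 0) :+ c)) R.refl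
            (re (x j)) (im (x j))

      erase-supported : ∀ {j L x} → x ∈ SupportedOn (j ∷ L) → erase j x ∈ SupportedOn L
      erase-supported {j} x∈ k k∉L with k ≟ᶠ j
      ... | yes _   = ℂ.refl
      ... | no  k≢j = x∈ k λ { (here k≡j) → k≢j k≡j ; (there k∈L) → k∉L k∈L }

      -- A complex coordinate j has two real directions, the basis vector and its multiple by i, so
      -- each entry of the list takes two Gram-Schmidt steps. What remains of x once entry j is
      -- erased falls under the induction hypothesis.
      controlled-supported : ∀ L → ∃[ P ] IsControlled P × SupportedOn L ⊆ P
      controlled-supported []      = (_≈ᵥ 0ᵥ) , trivial-controlled , λ x∈ k → x∈ k λ ()
      controlled-supported (j ∷ L) =
        let P , P-controlled , supported⊆P = controlled-supported L
            Q-controlled = extension-controlled P-controlled (unit i# j)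
            S-controlled = extension-controlled Q-controlled (unit ℂ.1# j)
        in _ , S-controlled , λ {x} x∈ →
          IsControlled.resp-≈ S-controlled (λ k → ℂ.sym (decompose j x k))
            (extension-comb Q-controlled (unit ℂ.1# j) (re (x j))
              (extension-comb P-controlled (unit i# j) (im (x j))
                (supported⊆P (erase-supported {j} {L} {x} x∈))))

    -- Every vector is supported on the list of all indices, so the bound of the last stage holds
    -- everywhere.
    dominated : ∃[ C ] R.0# R.≤ C × (∀ x → D x x R.≤ C R.* B x x)
    dominated =
      let P , P-controlled , everything⊆P = controlled-supported (allFin _)
          C , 0≤C , D≤CB = IsControlled.bound P-controlled
      in C , 0≤C , λ x → D≤CB (everything⊆P λ k k∉ → contradiction (∈-allFin k) k∉)

  -- Operators and states

  infixr 7 _•_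
  infixl 6 _⊞_

  _•_ : R.Carrier → Operator → Operator
  (k • M) i j = fromReal k ℂ.* M i j

  _⊞_ : Operator → Operator → Operator
  (M ⊞ N) i j = M i j ℂ.+ N i j

  infix 4 _≈ᴼ_
  _≈ᴼ_ : Operator → Operator → Set
  M ≈ᴼ N = ∀ i j → M i j ℂ.≈ N i j

  ⟨$⟩-cong : ∀ {M N} v → M ≈ᴼ N → M ⟨$⟩ v ≈ᵥ N ⟨$⟩ v
  ⟨$⟩-cong v M≈N i = ∙-congʳ v (M≈N i)

  form-cong : ∀ {M N} u v → M ≈ᴼ N → form M u v R.≈ form N u v
  form-cong u v M≈N = proj₁ (∙-congˡ (conj ∘ u) (⟨$⟩-cong v M≈N))

  •-⟨$⟩ : ∀ k M v → (k • M) ⟨$⟩ v ≈ᵥ fromReal k ·ᵥ (M ⟨$⟩ v)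
  •-⟨$⟩ k M v i = ∙-·ˡ (fromReal k) (M i) v

  form-• : ∀ k M u v → form (k • M) u v R.≈ k R.* form M u v
  form-• k M u v = R.trans
    (proj₁ (ℂ.trans (∙-congˡ (conj ∘ u) (•-⟨$⟩ k M v)) (∙-·ʳ (conj ∘ u) (fromReal k) (M ⟨$⟩ v))))
    (re-fromReal-* k ⟨ u ∣ M ⟨$⟩ v ⟩)

  form-⊞ : ∀ M N u v → form (M ⊞ N) u v R.≈ form M u v R.+ form N u v
  form-⊞ M N u v = proj₁ (ℂ.trans (∙-congˡ (conj ∘ u) (λ i → ∙-+ˡ (M i) (N i) v))
                                  (∙-+ʳ (conj ∘ u) (M ⟨$⟩ v) (N ⟨$⟩ v)))

  •-selfAdjoint : ∀ k {M} → IsSelfAdjoint M → IsSelfAdjoint (k • M)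
  •-selfAdjoint k {M} M†≈M i j = ℂ.trans (ℂ.*-cong (ℂ.sym (conj-fromReal k)) (M†≈M i j))
    (ℂ.sym (conj-* (fromReal k) (M j i)))

  ⊞-selfAdjoint : ∀ {M N} → IsSelfAdjoint M → IsSelfAdjoint N → IsSelfAdjoint (M ⊞ N)
  ⊞-selfAdjoint {M} {N} M†≈M N†≈N i j = ℂ.trans (ℂ.+-cong (M†≈M i j) (N†≈N i j))
      (ℂ.sym (conj-+ (M j i) (N j i)))

  ⊞-positive : ∀ {M N} → IsPositive M → IsPositive N → IsPositive (M ⊞ N)
  ⊞-positive {M} {N} (M†≈M , 0≤M) (N†≈N , 0≤N) = ⊞-selfAdjoint {M} {N} M†≈M N†≈N , λ v →
    ≤-respʳ-≈ (R.sym (form-⊞ M N v v)) (+-nonneg (0≤M v) (0≤N v))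

  •-positive : ∀ {k M} → R.0# R.≤ k → IsPositive M → IsPositive (k • M)
  •-positive {k} {M} 0≤k (M†≈M , 0≤M) = •-selfAdjoint k {M} M†≈M , λ v →
    ≤-respʳ-≈ (R.sym (form-• k M v v)) (R.*-nonneg 0≤k (0≤M v))

  -- Lets positive operators of any trace be replaced by states: a positive factor changes neither
  -- the kernel nor the property of being a positive combination.
  normalise : ∀ M → IsPositive M → ∃[ k ] R.0# R.< k × ∃[ σ ] operator σ ≈ᴼ k • M
  normalise M M≥0 = let k , 0<k@(0≤k , _) , k*tr≤1 = shrink-below-1 (re (trace M)) in
    k , 0<k , record
      { operator = k • M
      ; positive = •-positive {k} {M} 0≤k M≥0
      ; trace≤1  = ≤-respˡ-≈ (R.sym (R.trans (proj₁
          (ℂ.sym (ℂSum.*-distribˡ-sum (fromReal k) (λ i → M i i))))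
                                             (re-fromReal-* k (trace M)))) k*tr≤1
      } , λ _ _ → ℂ.refl

  -- The zero state and rank-one states

  0ᴼ : Operator
  0ᴼ _ _ = ℂ.0#

  zeroState : 𝒟
  zeroState = record
    { operator = 0ᴼ
    ; positive = (λ _ _ → ℂ.sym conj-0) , λ v → ≤-reflexive (R.sym (proj₁
        (ℂ.trans (∙-congˡ (conj ∘ v) (λ i → ℂ.trans (∙-comm 0ᵥ v) (∙-zeroʳ v)))
            (∙-zeroʳ (conj ∘ v)))))
    ; trace≤1  = ≤-respˡ-≈ (R.sym (proj₁ (ℂSum.sum-replicate-zero (2 ^ n)))) 0≤1
    }

  -- The operator |v⟩⟨v|, for v of any norm.
  outer : ℋ → Operator
  outer v i j = v i ℂ.* conj (v j)

  outer-⟨$⟩ : ∀ v u → outer v ⟨$⟩ u ≈ᵥ ⟨ v ∣ u ⟩ ·ᵥ v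
  outer-⟨$⟩ v u i = ℂ.trans (∙-·ˡ (v i) (conj ∘ v) u) (ℂ.*-comm (v i) ⟨ v ∣ u ⟩)

  -- The value is |⟨v|u⟩|², which yields positivity and shows that it vanishes only for u orthogonal
  -- to v.
  form-outer : ∀ v u → form (outer v) u u R.≈ re (conj ⟨ v ∣ u ⟩ ℂ.* ⟨ v ∣ u ⟩)
  form-outer v u = proj₁ (begin
    ⟨ u ∣ outer v ⟨$⟩ u ⟩             ≈⟨ ∙-congˡ (conj ∘ u) (outer-⟨$⟩ v u) ⟩
    ⟨ u ∣ ⟨ v ∣ u ⟩ ·ᵥ v ⟩            ≈⟨ ∙-·ʳ (conj ∘ u) ⟨ v ∣ u ⟩ v ⟩
    ⟨ v ∣ u ⟩ ℂ.* ⟨ u ∣ v ⟩           ≈⟨ ℂ.*-congˡ (⟨∣⟩-conj u v) ⟩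
    ⟨ v ∣ u ⟩ ℂ.* conj ⟨ v ∣ u ⟩      ≈⟨ ℂ.*-comm ⟨ v ∣ u ⟩ (conj ⟨ v ∣ u ⟩) ⟩
    conj ⟨ v ∣ u ⟩ ℂ.* ⟨ v ∣ u ⟩      ∎)
    where open SetoidReasoning ℂ.setoid

  outer-positive : ∀ v → IsPositive (outer v)
  outer-positive v =
    (λ i j → ℂ.trans (ℂ.*-comm (v i) (conj (v j)))
      (ℂ.trans (ℂ.*-congˡ (ℂ.sym (conj-involutive (v i)))) (ℂ.sym (conj-* (v j) (conj (v i)))))) ,
    λ u → ≤-respʳ-≈ (R.sym (form-outer v u)) (∣z∣²-nonneg ⟨ v ∣ u ⟩)

  -- For σ a positive multiple of |v⟩⟨v| the kernel is the orthogonal complement of v, so the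
  -- support is the line of v.
  rank-one : ∀ v → ¬ (re ⟨ v ∣ v ⟩ R.≈ R.0#) →
             ∃[ σ ] v ∈ carrier ⌈ σ ⌉ × (∀ {w} → w ∈ carrier ⌈ σ ⌉ → ∃[ z ] w ≈ᵥ z ·ᵥ v)
  rank-one v vv≉0 =
    let k , 0<k , σ , σ≈ = normalise (outer v) (outer-positive v)
    in σ , v∈⌈σ⌉ k 0<k σ σ≈ , multiple k σ σ≈
    where
    v∈⌈σ⌉ : ∀ k → R.0# R.< k → ∀ σ → operator σ ≈ᴼ k • outer v → v ∈ carrier ⌈ σ ⌉
    v∈⌈σ⌉ k 0<k σ σ≈ u σu≈0 = ⟨∣⟩-orthogonal-sym v u (∣z∣²≈0⇒z≈0 (R.trans (R.sym (form-outer v u))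
      (x*y≈0⇒y≈0 (0<⇒≉0 0<k) (R.trans (R.sym (R.trans (form-cong u u σ≈)
          (form-• k (outer v) u u))) (kernel⇒isotropic (operator σ) {u} σu≈0)))))

    v⊥⊆kernel : ∀ k {M u} → M ≈ᴼ k • outer v → ⟨ v ∣ u ⟩ ℂ.≈ ℂ.0# → u ∈ kernel M
    v⊥⊆kernel k {M} {u} M≈ v⊥u i = ℂ.trans (ℂ.trans (⟨$⟩-cong u M≈ i) (•-⟨$⟩ k (outer v) u i))
      (ℂ.trans (ℂ.*-congˡ (ℂ.trans (outer-⟨$⟩ v u i) (ℂ.trans (ℂ.*-congʳ v⊥u) (ℂ.zeroˡ (v i)))))
        (ℂ.zeroʳ (fromReal k)))

    t⁻¹ : R.Carrier
    t⁻¹ = proj₁ (R.inverse vv≉0)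

    t⁻¹*⟨v∣v⟩≈1 : fromReal t⁻¹ ℂ.* ⟨ v ∣ v ⟩ ℂ.≈ ℂ.1#
    t⁻¹*⟨v∣v⟩≈1 =
      R.trans (re-fromReal-* t⁻¹ ⟨ v ∣ v ⟩) (R.trans (R.*-comm t⁻¹ _) (proj₂ (R.inverse vv≉0))) ,
      R.trans (im-fromReal-* t⁻¹ ⟨ v ∣ v ⟩) (R.trans (R.*-congˡ im≈0) (R.zeroʳ t⁻¹))
      where
      im≈0 : im ⟨ v ∣ v ⟩ R.≈ R.0#
      im≈0 = selfConjugate (proj₂ (⟨∣⟩-conj v v))
        where
        selfConjugate : ∀ {b} → b R.≈ R.- b → b R.≈ R.0#
        -- From b = -b follows b² + b² = b² + (-b) b = 0, hence b² ≤ 0, with no division by 2.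
        selfConjugate {b} b≈-b = x*x≈0⇒x≈0 (antisym
          (≤-by-difference (x*x-nonneg b) (R.sym (R.trans (R.+-congˡ (R.*-congʳ b≈-b))
            (solve 1 (λ b → b :* b :+ (:- b) :* b := con (0 , 0)) R.refl b))))
          (x*x-nonneg b))

    -- With z = ⟨v|w⟩ / ⟨v|v⟩, the vector u = w - z v is orthogonal to v and thus in the kernel of
    -- σ. Being in the support, w is orthogonal to u, hence so is u itself, and u = 0.
    multiple : ∀ k σ → operator σ ≈ᴼ k • outer v → ∀ {w} → w ∈ carrier ⌈ σ ⌉ → ∃[ z ] w ≈ᵥ z ·ᵥ v
    multiple k σ σ≈ {w} w∈⌈σ⌉ = z , λ i → w≈ i (⟨v∣v⟩≈0⇒v≈0 u (proj₁ ⟨u∣u⟩≈0) i)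
      where
      z : ℂ
      z = fromReal t⁻¹ ℂ.* ⟨ v ∣ w ⟩

      u : ℋ
      u = w +ᵥ (ℂ.- z) ·ᵥ v

      u-inner : ∀ x → ⟨ x ∣ u ⟩ ℂ.≈ ⟨ x ∣ w ⟩ ℂ.+ (ℂ.- z) ℂ.* ⟨ x ∣ v ⟩
      u-inner x = ℂ.trans (∙-+ʳ (conj ∘ x) w ((ℂ.- z) ·ᵥ v)) (ℂ.+-congˡ (∙-·ʳ (conj ∘ x) (ℂ.- z) v))

      v⊥u : ⟨ v ∣ u ⟩ ℂ.≈ ℂ.0#
      v⊥u = begin
        ⟨ v ∣ u ⟩
          ≈⟨ u-inner v ⟩
        ⟨ v ∣ w ⟩ ℂ.+ (ℂ.- z) ℂ.* ⟨ v ∣ v ⟩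
          ≈⟨ ℂS.solve 3 (λ t p q → p ℂS.:+ (ℂS.:- (t ℂS.:* p)) ℂS.:* q ℂS.:=
             p ℂS.:+ (ℂS.:- (p ℂS.:* (t ℂS.:* q))))
               ℂ.refl (fromReal t⁻¹) ⟨ v ∣ w ⟩ ⟨ v ∣ v ⟩ ⟩
        ⟨ v ∣ w ⟩ ℂ.- ⟨ v ∣ w ⟩ ℂ.* (fromReal t⁻¹ ℂ.* ⟨ v ∣ v ⟩)
          ≈⟨ ℂ.+-congˡ (ℂ.-‿cong (ℂ.trans (ℂ.*-congˡ t⁻¹*⟨v∣v⟩≈1) (ℂ.*-identityʳ ⟨ v ∣ w ⟩))) ⟩
        ⟨ v ∣ w ⟩ ℂ.- ⟨ v ∣ w ⟩
          ≈⟨ ℂ.-‿inverseʳ ⟨ v ∣ w ⟩ ⟩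
        ℂ.0# ∎
        where
        open SetoidReasoning ℂ.setoid

      ⟨u∣u⟩≈0 : ⟨ u ∣ u ⟩ ℂ.≈ ℂ.0#
      ⟨u∣u⟩≈0 = ℂ.trans (u-inner u) (ℂ.trans
        (ℂ.+-cong (w∈⌈σ⌉ u (v⊥⊆kernel k {operator σ} {u} σ≈ v⊥u))
            (ℂ.*-congˡ (⟨∣⟩-orthogonal-sym v u v⊥u)))
        (ℂ.trans (ℂ.+-identityˡ _) (ℂ.zeroʳ (ℂ.- z))))

      w≈ : ∀ i → u i ℂ.≈ ℂ.0# → w i ℂ.≈ z ℂ.* v i
      w≈ i ui≈0 = begin
        w i
          ≈⟨ ℂS.solve 3 (λ w z v → w ℂS.:= (w ℂS.:+ (ℂS.:- z) ℂS.:* v) ℂS.:+ z ℂS.:* v) ℂ.refl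
             (w i) z (v i) ⟩
        u i ℂ.+ z ℂ.* v i                        ≈⟨ ℂ.+-congʳ ui≈0 ⟩
        ℂ.0# ℂ.+ z ℂ.* v i                       ≈⟨ ℂ.+-identityˡ _ ⟩
        z ℂ.* v i                                ∎
        where open SetoidReasoning ℂ.setoid

  -- The line of a non-zero v lies in P, so the rank-one state of v belongs to `γₛ P`. The zero
  -- vector lies in every span.
  ∈αₛγₛ : ∀ P {v} → v ∈ carrier P → v ∈ carrier (αₛ (γₛ P))
  ∈αₛγₛ P {v} v∈P with re ⟨ v ∣ v ⟩ ≈? R.0#
  ... | yes vv≈0 = resp (λ i → ℂ.sym (⟨v∣v⟩≈0⇒v≈0 v vv≈0 i)) zero
  ... | no  vv≉0 = let σ , v∈⌈σ⌉ , multiple = rank-one v vv≉0 in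
    generator ((σ , λ {w} w∈⌈σ⌉ → let z , w≈zv = multiple {w} w∈⌈σ⌉ in
      ≈-closed P (λ i → ℂ.sym (w≈zv i)) (·-closed P z v∈P)) , v∈⌈σ⌉)

  -- Sums of at most two states

  private
    ≈⇒≈[] : ∀ {x y ε} → R.0# R.< ε → x R.≈ y → x ≈[ ε ] y
    ≈⇒≈[] (0≤ε , _) x≈y = ≤-by-difference 0≤ε (R.+-congʳ (R.sym x≈y)) ,
      ≤-by-difference 0≤ε (R.+-congʳ x≈y)

  -- The only list over `Fin 0` is empty and its sum is exactly 0. Through property (b) this puts
  -- the zero state into every γ a.
  empty-hasSum : (x : Fin 0 → R.Carrier) (ρ : Fin 0 → 𝒟) → HasSum x ρ zeroState
  empty-hasSum x ρ ε 0<ε = [] , λ { [] _ _ j k → ≈⇒≈[] 0<ε R.refl , ≈⇒≈[] 0<ε R.refl }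

  -- A list of Booleans without repetition that contains both is one of the two orderings, so the
  -- partial sums beyond F₀ are already exact; all other shapes are contradictory.
  binary-hasSum : ∀ (x : Bool → R.Carrier) (ρ : Bool → 𝒟) σ →
    operator σ ≈ᴼ (x true • operator (ρ true) ⊞ x false • operator (ρ false)) →
    HasSum x ρ σ
  binary-hasSum x ρ σ σ≈ ε 0<ε = true ∷ false ∷ [] , λ F unique ⊆F j k →
    let sum≈σ = sum F unique (⊆F (here ≡.refl)) (⊆F (there (here ≡.refl))) j k
    in ≈⇒≈[] 0<ε (proj₁ sum≈σ) , ≈⇒≈[] 0<ε (proj₂ sum≈σ)
    where
    sum : ∀ F → Unique F → true List.∈ F → false List.∈ F → ∀ j k →
          finiteSum x ρ F j k ℂ.≈ operator σ j k
    sum (true ∷ false ∷ []) _ _ _ j k =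
      ℂ.trans (ℂ.+-congˡ (ℂ.+-identityʳ _)) (ℂ.sym (σ≈ j k))
    sum (false ∷ true ∷ []) _ _ _ j k =
      ℂ.trans (ℂ.+-congˡ (ℂ.+-identityʳ _)) (ℂ.trans (ℂ.+-comm _ _) (ℂ.sym (σ≈ j k)))
    sum (true ∷ [])  _ _ (here ()) j k
    sum (true ∷ [])  _ _ (there ()) j k
    sum (false ∷ []) _ (here ()) _ j k
    sum (false ∷ []) _ (there ()) _ j k
    sum (true ∷ true ∷ _)   ((≢ ∷ _) ∷ _) = contradiction ≡.refl ≢
    sum (false ∷ false ∷ _) ((≢ ∷ _) ∷ _) = contradiction ≡.refl ≢
    sum (true ∷ false ∷ true ∷ _)  ((_ ∷ ≢ ∷ _) ∷ _) = contradiction ≡.refl ≢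
    sum (true ∷ false ∷ false ∷ _) (_ ∷ (≢ ∷ _) ∷ _) = contradiction ≡.refl ≢
    sum (false ∷ true ∷ false ∷ _) ((_ ∷ ≢ ∷ _) ∷ _) = contradiction ≡.refl ≢
    sum (false ∷ true ∷ true ∷ _)  (_ ∷ (≢ ∷ _) ∷ _) = contradiction ≡.refl ≢

  -- Splitting a state off one with a smaller kernel

  column∈⌈⌉ : ∀ ρ j → column (operator ρ) j ∈ carrier ⌈ ρ ⌉
  column∈⌈⌉ ρ j u ρu≈0 = ℂ.trans (⟨∣column⟩ {operator ρ} (proj₁ (positive ρ)) u j)
    (ℂ.trans (conj-cong (ρu≈0 j)) conj-0)

  -- By hypothesis the form of ρ vanishes where that of τ does, so ρ ≤ Cτ for some C. For ε = 1/(1 +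
  -- C) the remainder τ - ερ = ε (τ + (Cτ - ρ)) is positive; ω is k times it, with k chosen by
  -- `normalise`, and δ = 1/k undoes that scaling.
  split : ∀ ρ τ → (∀ {u} → form (operator τ) u u R.≈ R.0# → u ∈ kernel (operator ρ)) →
    ∃[ ε ] ∃[ δ ] ∃[ ω ] R.0# R.< ε × R.0# R.< δ ×
      operator τ ≈ᴼ ε • operator ρ ⊞ δ • operator ω
  split ρ τ kernel⊆ =
    let C , 0≤C , ρ≤Cτ = dominated
        -- The inverse of 1 + C is taken because C itself may be 0.
        ε , 0<ε@(0≤ε , _) , [1+C]ε≈1 = positive-inverse (0≤⇒0<1+ 0≤C)
        D = operator τ ⊞ (R.- ε) • operator ρ
        D≥0 : IsPositive D
        D≥0 = ⊞-selfAdjoint {operator τ} {(R.- ε) • operator ρ} (proj₁ (positive τ))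
            (•-selfAdjoint (R.- ε) {operator ρ} (proj₁ (positive ρ))) ,
          λ v → ≤-respʳ-≈ (R.sym (form-D ε [1+C]ε≈1 v))
            (R.*-nonneg 0≤ε (+-nonneg (proj₂ (positive τ) v) (x≤y⇒0≤y-x (ρ≤Cτ v))))
        k , 0<k , ω , ω≈kD = normalise D D≥0
        δ , 0<δ , kδ≈1 = positive-inverse 0<k
    in ε , δ , ω , 0<ε , 0<δ , λ i j → ℂ.sym (recombine ε k δ kδ≈1 ω ω≈kD i j)
    where
    open Domination (form-positive {operator τ} (positive τ))
        (form-positive {operator ρ} (positive ρ))
      (λ {v} vτv≈0 → kernel⇒isotropic (operator ρ) {v} (kernel⊆ vτv≈0))

    open SetoidReasoning R.setoid

    form-D : ∀ {C} ε → (R.1# R.+ C) R.* ε R.≈ R.1# → ∀ v →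
      form (operator τ ⊞ (R.- ε) • operator ρ) v v R.≈
      ε R.* (form (operator τ) v v R.+ (C R.* form (operator τ) v v R.- form (operator ρ) v v))
    form-D {C} ε [1+C]ε≈1 v = begin
      form (operator τ ⊞ (R.- ε) • operator ρ) v v
        ≈⟨ form-⊞ (operator τ) ((R.- ε) • operator ρ) v v ⟩
      t R.+ form ((R.- ε) • operator ρ) v v
        ≈⟨ R.+-congˡ (form-• (R.- ε) (operator ρ) v v) ⟩
      t R.+ (R.- ε) R.* r
        ≈⟨ R.+-congʳ (R.trans (R.*-congʳ [1+C]ε≈1) (R.*-identityˡ t)) ⟨
      (R.1# R.+ C) R.* ε R.* t R.+ (R.- ε) R.* r
        ≈⟨ solve 4 (λ C ε t r → (con (1 , 0) :+ C) :* ε :* t :+ (:- ε) :* r :=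
           ε :* (t :+ (C :* t :- r))) R.refl C ε t r ⟩
      ε R.* (t R.+ (C R.* t R.- r)) ∎
      where
      t = form (operator τ) v v
      r = form (operator ρ) v v

    recombine : ∀ ε k δ → k R.* δ R.≈ R.1# → ∀ ω →
      operator ω ≈ᴼ k • (operator τ ⊞ (R.- ε) • operator ρ) → ∀ i j →
      (ε • operator ρ ⊞ δ • operator ω) i j ℂ.≈ operator τ i j
    recombine ε k δ kδ≈1 ω ω≈kD i j =
      law (re-fromReal-* ε r) (re-fromReal-* δ _)
          (R.trans (proj₁ (ω≈kD i j)) (re-fromReal-* k _)) (re-fromReal-* (R.- ε) r) ,
      law (im-fromReal-* ε r) (im-fromReal-* δ _)
          (R.trans (proj₂ (ω≈kD i j)) (im-fromReal-* k _)) (im-fromReal-* (R.- ε) r)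
      where
      r = operator ρ i j

      law : ∀ {a b c d t r} → a R.≈ ε R.* r → b R.≈ δ R.* c → c R.≈ k R.* (t R.+ d) →
          d R.≈ (R.- ε) R.* r → a R.+ b R.≈ t
      law {a} {b} {c} {d} {t} {r} a≈ b≈ c≈ d≈ = begin
        a R.+ b
          ≈⟨ R.+-cong a≈ (R.trans b≈ (R.*-congˡ (R.trans c≈ (R.*-congˡ (R.+-congˡ d≈))))) ⟩
        ε R.* r R.+ δ R.* (k R.* (t R.+ (R.- ε) R.* r))
          ≈⟨ solve 5 (λ ε r δ k t → ε :* r :+ δ :* (k :* (t :+ (:- ε) :* r)) :=
             ε :* r :+ (k :* δ) :* (t :+ (:- ε) :* r)) R.refl ε r δ k t ⟩
        ε R.* r R.+ k R.* δ R.* (t R.+ (R.- ε) R.* r)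
          ≈⟨ R.+-congˡ (R.*-congʳ kδ≈1) ⟩
        ε R.* r R.+ R.1# R.* (t R.+ (R.- ε) R.* r)
          ≈⟨ solve 3 (λ ε r t → ε :* r :+ con (1 , 0) :* (t :+ (:- ε) :* r) := t) R.refl ε r t ⟩
        t ∎

  -- Faces: sets of states that contain a positive combination if and only if they contain its terms

  record IsFace (Q : 𝒬) : Set₁ where
    field
      zero∈     : zeroState ∈ member Q
      sum∈      : ∀ {ρ σ τ x y} → R.0# R.< x → R.0# R.< y →
                  operator τ ≈ᴼ x • operator ρ ⊞ y • operator σ →
                  ρ ∈ member Q → σ ∈ member Q → τ ∈ member Q
      summand∈  : ∀ {ρ σ τ x y} → R.0# R.< x → R.0# R.< y →
                  operator τ ≈ᴼ x • operator ρ ⊞ y • operator σ →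
                  τ ∈ member Q → ρ ∈ member Q

  module _ {Q : 𝒬} (Q-face : IsFace Q) where

    open IsFace Q-face

    private
      -- This is membership of v in the support of τ, with the kernel of τ expressed by isotropic
      -- vectors: the quadratic form is additive in τ and nonnegative, which suits `combine`.
      Detects : 𝒟 → Pred ℋ 0ℓ
      Detects τ v = ∀ {u} → form (operator τ) u u R.≈ R.0# → ⟨ u ∣ v ⟩ ℂ.≈ ℂ.0#

      -- The state is a scaled sum of the two. Where the form of the sum vanishes, both of its
      -- nonnegative terms vanish.
      combine : ∀ τ₁ τ₂ → τ₁ ∈ member Q → τ₂ ∈ member Q → ∃[ τ ] τ ∈ member Q ×
        (∀ {u} → form (operator τ) u u R.≈ R.0# →
          form (operator τ₁) u u R.≈ R.0# × form (operator τ₂) u u R.≈ R.0#)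
      combine τ₁ τ₂ τ₁∈Q τ₂∈Q =
        let k , 0<k , τ , τ≈ = normalise (operator τ₁ ⊞ operator τ₂)
              (⊞-positive {operator τ₁} {operator τ₂} (positive τ₁) (positive τ₂))
        in τ , sum∈ {τ₁} {τ₂} {τ} 0<k 0<k
          (λ i j → ℂ.trans (τ≈ i j) (ℂ.distribˡ (fromReal k) (operator τ₁ i j)
              (operator τ₂ i j))) τ₁∈Q τ₂∈Q ,
        λ {u} uτu≈0 →
          let sum≈0 = R.trans (R.sym (form-⊞ (operator τ₁) (operator τ₂) u u))
                (x*y≈0⇒y≈0 (0<⇒≉0 0<k) (R.trans
                    (R.sym (R.trans (form-cong u u τ≈)
                        (form-• k (operator τ₁ ⊞ operator τ₂) u u))) uτu≈0))
          in x+y≈0⇒x≈0 (proj₂ (positive τ₁) u) (proj₂ (positive τ₂) u) sum≈0 ,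
             x+y≈0⇒y≈0 (proj₂ (positive τ₁) u) (proj₂ (positive τ₂) u) sum≈0

      -- Membership in a span is a finite derivation: each generator brings its own state, and each
      -- addition merges two states by `combine`, which only enlarges the support.
      detect : ∀ {v} → v ∈ carrier (αₛ Q) → ∃[ τ ] τ ∈ member Q × v ∈ Detects τ
      detect (generator ((σ , σ∈Q) , v∈⌈σ⌉)) = σ , σ∈Q , λ {u} uσu≈0 →
        v∈⌈σ⌉ u (isotropic⇒kernel {operator σ} (positive σ) {u} uσu≈0)
      detect (resp {v} {w} v≈w v∈) = let τ , τ∈Q , det = detect v∈ in τ , τ∈Q , λ {u} uτu≈0 →
        ℂ.trans (∙-congˡ (conj ∘ u) (λ i → ℂ.sym (v≈w i))) (det {u} uτu≈0)
      detect zero = zeroState , zero∈ , λ {u} _ → ∙-zeroʳ (conj ∘ u)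
      detect (plus {v} {w} v∈ w∈) =
        let τ₁ , τ₁∈Q , det₁ = detect v∈
            τ₂ , τ₂∈Q , det₂ = detect w∈
            τ , τ∈Q , both = combine τ₁ τ₂ τ₁∈Q τ₂∈Q
        in τ , τ∈Q , λ {u} uτu≈0 → ℂ.trans (∙-+ʳ (conj ∘ u) v w)
             (ℂ.trans (ℂ.+-cong (det₁ {u} (proj₁ (both uτu≈0))) (det₂ {u} (proj₂ (both uτu≈0))))
                 (ℂ.+-identityˡ ℂ.0#))
      detect (scale z {v} v∈) = let τ , τ∈Q , det = detect v∈ in τ , τ∈Q , λ {u} uτu≈0 →
        ℂ.trans (∙-·ʳ (conj ∘ u) z v) (ℂ.trans (ℂ.*-congˡ (det {u} uτu≈0)) (ℂ.zeroʳ z))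

      detect-all : ∀ {m} (v : Fin m → ℋ) → (∀ j → v j ∈ carrier (αₛ Q)) →
                   ∃[ τ ] τ ∈ member Q × (∀ j → v j ∈ Detects τ)
      detect-all {ℕ.zero}  v v∈ = zeroState , zero∈ , λ ()
      detect-all {ℕ.suc m} v v∈ =
        let τ₁ , τ₁∈Q , det₁ = detect (v∈ zero)
            τ₂ , τ₂∈Q , det₂ = detect-all (v ∘ suc) (λ j → v∈ (suc j))
            τ , τ∈Q , both = combine τ₁ τ₂ τ₁∈Q τ₂∈Q
        in τ , τ∈Q , λ where
          zero    {u} uτu≈0 → det₁ {u} (proj₁ (both uτu≈0))
          (suc j) {u} uτu≈0 → det₂ j {u} (proj₂ (both uτu≈0))

    -- A single τ in Q has all columns of ρ in its support. An isotropic vector of τ is then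
    -- orthogonal to every column of ρ, so it is in the kernel of ρ, and `split` makes ρ a summand
    -- of τ.
    γₛαₛ-face : member (γₛ (αₛ Q)) ⊆ member Q
    γₛαₛ-face {ρ} ⌈ρ⌉⊆αₛQ =
      let τ , τ∈Q , det = detect-all (column (operator ρ)) (λ j → ⌈ρ⌉⊆αₛQ (column∈⌈⌉ ρ j))
          ε , δ , ω , 0<ε , 0<δ , τ≈ = split ρ τ λ {u} uτu≈0 j → conj≈0⇒≈0
            (ℂ.trans (ℂ.sym (⟨∣column⟩ {operator ρ} (proj₁ (positive ρ)) u j)) (det j {u} uτu≈0))
      in summand∈ {ρ} {ω} {τ} 0<ε 0<δ τ≈ τ∈Q

  -- Monotonicity of `αₛ` and the inclusion of Q in its closure

  αₛ-mono : ∀ {Q Q′} → member Q ⊆ member Q′ → carrier (αₛ Q) ⊆ carrier (αₛ Q′)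
  αₛ-mono Q⊆Q′ (generator ((ρ , ρ∈Q) , v∈⌈ρ⌉)) = generator ((ρ , Q⊆Q′ ρ∈Q) , v∈⌈ρ⌉)
  αₛ-mono {Q} {Q′} Q⊆Q′ (resp v≈w v∈) = resp v≈w (αₛ-mono {Q} {Q′} Q⊆Q′ v∈)
  αₛ-mono Q⊆Q′ zero = zero
  αₛ-mono {Q} {Q′} Q⊆Q′ (plus v∈ w∈) = plus (αₛ-mono {Q} {Q′} Q⊆Q′ v∈) (αₛ-mono {Q} {Q′} Q⊆Q′ w∈)
  αₛ-mono {Q} {Q′} Q⊆Q′ (scale z v∈) = scale z (αₛ-mono {Q} {Q′} Q⊆Q′ v∈)

  ⊆γₛαₛ : ∀ Q → member Q ⊆ member (γₛ (αₛ Q))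
  ⊆γₛαₛ Q {ρ} ρ∈Q v∈⌈ρ⌉ = generator ((ρ , ρ∈Q) , v∈⌈ρ⌉)

  -- Concretisations in a well-structured domain are faces

  module _ {c ℓ₁ ℓ₂} {A : CompleteLattice c ℓ₁ ℓ₂}
    {α : PosetHomomorphism 𝒬-poset (CompleteLattice.poset A)}
    {γ : PosetHomomorphism (CompleteLattice.poset A) 𝒬-poset}
    (wellStructured : IsWellStructured A α γ) where

    private
      module A = CompleteLattice A
      module α = PosetHomomorphism α
      module γ = PosetHomomorphism γ
      open IsWellStructured wellStructured

      -- With its converse below, this turns membership in γ a into an inequality in the lattice, to
      -- which property (b) applies.
      ∈γ⇒α≤ : ∀ {ρ a} → ρ ∈ member γ.⟦ a ⟧ → α.⟦ ｛ ρ ｝ ⟧ A.≤ a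
      ∈γ⇒α≤ {ρ} {a} ρ∈γa = Equivalence.to (proj₁ isGaloisEmbedding ｛ ρ ｝ a)
        (λ {σ} ρ≈σ → respects γ.⟦ a ⟧ {ρ} {σ} ρ≈σ ρ∈γa)

      α≤⇒∈γ : ∀ {ρ a} → α.⟦ ｛ ρ ｝ ⟧ A.≤ a → ρ ∈ member γ.⟦ a ⟧
      α≤⇒∈γ {ρ} {a} α≤a = Equivalence.from (proj₁ isGaloisEmbedding ｛ ρ ｝ a) α≤a {ρ}
          (λ i j → ℂ.refl)

      α-binary : ∀ {ρ σ τ x y} → R.0# R.< x → R.0# R.< y →
        operator τ ≈ᴼ x • operator ρ ⊞ y • operator σ →
        α.⟦ ｛ τ ｝ ⟧ A.≈ A.⋁ {Bool} (λ b → α.⟦ ｛ if b then ρ else σ ｝ ⟧)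
      α-binary {ρ} {σ} {τ} {x} {y} 0<x 0<y τ≈ = α-sum {Bool} weight state τ
        (λ { true → 0<x ; false → 0<y }) (binary-hasSum weight state τ τ≈)
        where
        weight : Bool → R.Carrier
        weight b = if b then x else y
        state : Bool → 𝒟
        state b = if b then ρ else σ

      no-states : Fin 0 → 𝒟
      no-states ()

      no-weights : Fin 0 → R.Carrier
      no-weights ()

      α-zero : α.⟦ ｛ zeroState ｝ ⟧ A.≈ A.⋁ (λ i → α.⟦ ｛ no-states i ｝ ⟧)
      α-zero = α-sum no-weights no-states zeroState (λ ()) (empty-hasSum no-weights no-states)

    -- By property (b), the abstraction of a combination is the join of those of its terms, and a
    -- join is below a exactly when all its members are. The zero state corresponds to the empty
    -- join.
    γ-face : ∀ a → IsFace γ.⟦ a ⟧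
    γ-face a = record
      { zero∈    = α≤⇒∈γ {zeroState} (A.trans (A.reflexive α-zero) (A.⋁-least _ a λ ()))
      ; sum∈     = λ {ρ} {σ} {τ} 0<x 0<y τ≈ ρ∈ σ∈ → α≤⇒∈γ {τ}
          (A.trans (A.reflexive (α-binary {ρ} {σ} {τ} 0<x 0<y τ≈))
                     (A.⋁-least _ a λ { true → ∈γ⇒α≤ {ρ} ρ∈ ; false → ∈γ⇒α≤ {σ} σ∈ }))
      ; summand∈ = λ {ρ} {σ} {τ} 0<x 0<y τ≈ τ∈ → α≤⇒∈γ {ρ}
          (A.trans (A.⋁-upper {Bool} (λ b → α.⟦ ｛ if b then ρ else σ ｝ ⟧) true)
                     (A.trans (A.reflexive (A.Eq.sym (α-binary {ρ} {σ} {τ} 0<x 0<y τ≈)))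
                         (∈γ⇒α≤ {τ} τ∈)))
      }

-- The factorisation through the subspace domain

mainTheorem3 : ∀ {c ℓ₁ ℓ₂ : Level} (R : CompleteOrderedField) (n : ℕ) →
    let open Quantum R n in
    (A : CompleteLattice c ℓ₁ ℓ₂) →
    let open CompleteLattice A using (poset)
        open Poset poset using (_≈_)
        open Poset 𝒬-poset using () renaming (_≈_ to _≈𝒬_)
        open PosetHomomorphism using (⟦_⟧)
    in
    (α : PosetHomomorphism 𝒬-poset poset) (γ : PosetHomomorphism poset 𝒬-poset) →
    IsWellStructured A α γ →
    ∃[ α′ ] ∃[ γ′ ]
      IsGaloisEmbedding 𝒮-poset poset α′ γ′ ×
      (∀ Q → ⟦ α ⟧ Q ≈ ⟦ α′ ⟧ (αₛ Q)) ×
      (∀ a → ⟦ γ ⟧ a ≈𝒬 γₛ (⟦ γ′ ⟧ a))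
mainTheorem3 R n A α γ wellStructured = α′ , γ′ , (galois , embedding) , α-factors , γ-factors
  where
  open Quantum R n
  open Vectors R n
  module A = CompleteLattice A
  module α = PosetHomomorphism α
  module γ = PosetHomomorphism γ
  open IsWellStructured wellStructured

  γₛαₛγ⊆γ : ∀ a → member (γₛ (αₛ γ.⟦ a ⟧)) ⊆ member γ.⟦ a ⟧
  γₛαₛγ⊆γ a {ρ} = γₛαₛ-face (γ-face wellStructured a) {ρ}

  γₛ-mono : ∀ {P P′} → carrier P ⊆ carrier P′ → member (γₛ P) ⊆ member (γₛ P′)
  γₛ-mono P⊆P′ ⌈ρ⌉⊆P v∈ = P⊆P′ (⌈ρ⌉⊆P v∈)

  α-mono : ∀ {Q Q′} → member Q ⊆ member Q′ → α.⟦ Q ⟧ A.≤ α.⟦ Q′ ⟧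
  α-mono {Q} {Q′} Q⊆Q′ = α.mono {Q} {Q′} Q⊆Q′

  α′ : PosetHomomorphism 𝒮-poset A.poset
  α′ = mkPosetHomo 𝒮-poset A.poset (λ P → α.⟦ γₛ P ⟧)
    (λ {P} {P′} P⊆P′ → α-mono {γₛ P} {γₛ P′} (λ {ρ} → γₛ-mono {P} {P′} P⊆P′ {ρ}))

  γ′ : PosetHomomorphism A.poset 𝒮-poset
  γ′ = mkPosetHomo A.poset 𝒮-poset (λ a → αₛ γ.⟦ a ⟧)
    (λ {a} {b} a≤b → αₛ-mono {γ.⟦ a ⟧} {γ.⟦ b ⟧} (γ.mono a≤b))

  -- Forwards, applying `γₛ` to P ⊆ αₛ (γ a) gives γₛ P ⊆ γ a through `γₛαₛγ⊆γ`. Backwards, P ⊆ αₛ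
  -- (γₛ P) and γₛ P ⊆ γ a.
  galois : IsGaloisConnection 𝒮-poset A.poset α′ γ′
  galois P a = mk⇔
    (λ P⊆ → Equivalence.to (proj₁ isGaloisEmbedding (γₛ P) a)
      λ {ρ} ρ∈ → γₛαₛγ⊆γ a {ρ} (γₛ-mono {P} {αₛ γ.⟦ a ⟧} (λ {v} → P⊆ {v}) {ρ} ρ∈))
    (λ α≤ {v} v∈P → αₛ-mono {γₛ P} {γ.⟦ a ⟧}
      (λ {ρ} → Equivalence.from (proj₁ isGaloisEmbedding (γₛ P) a) α≤ {ρ}) (∈αₛγₛ P v∈P))

  embedding : ∀ a → α.⟦ γₛ (αₛ γ.⟦ a ⟧) ⟧ A.≈ a
  embedding a = A.Eq.trans
    (A.antisym (α-mono {γₛ (αₛ γ.⟦ a ⟧)} {γ.⟦ a ⟧} (λ {ρ} → γₛαₛγ⊆γ a {ρ}))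
               (α-mono {γ.⟦ a ⟧} {γₛ (αₛ γ.⟦ a ⟧)} (λ {ρ} → ⊆γₛαₛ γ.⟦ a ⟧ {ρ})))
    (proj₂ isGaloisEmbedding a)

  -- Since Q ⊆ γ (α Q), the closure γₛ (αₛ Q) also stays inside γ (α Q), and its abstraction is
  -- therefore no larger than α Q.
  α-factors : ∀ Q → α.⟦ Q ⟧ A.≈ α.⟦ γₛ (αₛ Q) ⟧
  α-factors Q = A.antisym (α-mono {Q} {γₛ (αₛ Q)} (λ {ρ} → ⊆γₛαₛ Q {ρ}))
    (Equivalence.to (proj₁ isGaloisEmbedding (γₛ (αₛ Q)) α.⟦ Q ⟧) λ {ρ} ρ∈ →
      γₛαₛγ⊆γ α.⟦ Q ⟧ {ρ} (γₛ-mono {αₛ Q} {αₛ γ.⟦ α.⟦ Q ⟧ ⟧}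
        (λ {v} → αₛ-mono {Q} {γ.⟦ α.⟦ Q ⟧ ⟧} (λ {σ} → Equivalence.from
            (proj₁ isGaloisEmbedding Q α.⟦ Q ⟧) A.refl {σ}) {v}) {ρ} ρ∈))

  γ-factors : ∀ a → Poset._≈_ 𝒬-poset γ.⟦ a ⟧ (γₛ (αₛ γ.⟦ a ⟧))
  γ-factors a = (λ {ρ} → ⊆γₛαₛ γ.⟦ a ⟧ {ρ}) , (λ {ρ} → γₛαₛγ⊆γ a {ρ})
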